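{- Let $m\ge 1$ be an integer. Then \[ \sum_{\lambda \vdash m} x^{v(\lambda)}\,y^{v(\lambda')}\,q^{d(\lambda)}\,t^{d(\lambda')}\,I_\lambda=(x+y)^{\lfloor m/2\rfloor}, \] as polynomials in the indeterminates $x,y,q,t$.
   Context: Partitions are identified with their Young diagrams; $\lambda'$ denotes the conjugate partition and $l(\lambda)$ the number of nonzero parts. Define $v(\lambda)=\sum_{i=1}^{l(\lambda)}\lfloor \lambda_i/2\rfloor$ and $d(\lambda)=\sum_{i=1}^{\lfloor l(\lambda)/2\rfloor}\lfloor \lambda_{2i}/2\rfloor$ (one has $d(\lambda)=d(\lambda')$). For a standard Young tableau $T$ of shape $\lambda\vdash m$, its reading word is obtained by reading the entries of the first (top) row from left to right, then the second row from left to right, and so on; this is a permutation of $[m]$, and $\mathrm{sign}(T)$ is the sign of this permutation. The sign-imbalance of $\lambda$ is $I_\lambda=\sum_T \mathrm{sign}(T)$, the sum over all standard Young tableaux $T$ of shape $\lambda$. -}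

module Defs where

open import Algebra.Bundles.Raw using (RawSemiring)
open import Data.Bool.Base using (if_then_else_)
open import Data.Fin.Base using (Fin)
open import Data.Integer.Base as ℤ using (ℤ; 0ℤ; 1ℤ; -1ℤ)
open import Data.List.Base using
  (List; []; _∷_; _++_; map; foldr; filter; length; concat; concatMap; upTo; applyUpTo; zip; cartesianProductWith)
open import Data.List.Membership.DecPropositional using () renaming (_∈?_ to mem?)
open import Data.List.Membership.Propositional using (_∈_; lose)
open import Data.List.Membership.Propositional.Properties
open import Data.List.Properties using (∷-injective; ≡-dec)
open import Data.List.Relation.Binary.Permutation.Propositional
  using (_↭_; ↭-refl; ↭-sym; ↭-trans; ↭-prep)
open import Data.List.Relation.Binary.Permutation.Propositional.Properties
  using (∈-resp-↭; drop-∷; shift; ¬x∷xs↭[])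
open import Data.List.Relation.Unary.All using (All; []; _∷_; all?; tabulate; lookup; universal)
open import Data.List.Relation.Unary.All.Properties using () renaming (map⁺ to All-map⁺)
open import Data.List.Relation.Unary.AllPairs using ([]; _∷_)
import Data.List.Relation.Unary.AllPairs as AllPairs
import Data.List.Relation.Unary.AllPairs.Properties as AllPairs
open import Data.List.Relation.Unary.Any using (here; there)
open import Data.List.Relation.Unary.Linked using (Linked; linked?)
open import Data.List.Relation.Unary.Unique.Propositional using (Unique)
import Data.List.Relation.Unary.Unique.Propositional.Properties as Unique
open import Data.Nat.Base using (ℕ; zero; suc; _+_; _≤_; _<_; _≥_; _>_; _⊔_; ⌊_/2⌋; s≤s; z≤n)
open import Data.Nat.Properties
  using (_≟_; _≤?_; _<?_; _≥?_; _>?_; suc-injective; ≤-trans; <⇒≢; m≤m+n; m≤n+m; +-mono-≤)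
open import Data.Nat.ListAction using (sum)
open import Data.Product using (_×_; _,_; proj₂; uncurry)
open import Data.Vec.Base as Vec using (Vec; _[_]≔_)
import Data.Vec.Properties as Vec
open import Function.Base using (_∘_)
open import Function.Bundles using (_⇔_; mk⇔)
open import Relation.Binary.PropositionalEquality
  using (_≡_; refl; sym; trans; cong)
open import Relation.Nullary using (Dec; yes; no; does; map′; _×-dec_)

private variable
  A : Set

------------------------------------------------------------------------
-- Polynomials with integer coefficients in n commuting indeterminates

-- A finite formal sum of terms c · x₁^e₁ ⋯ xₙ^eₙ.  Terms may repeat or have
-- coefficient zero, so polynomials are compared by _≈ₚ_, not by _≡_.
Poly : ℕ → Set
Poly n = List (ℤ × Vec ℕ n)

module _ {n : ℕ} where

  coeff : Poly n → Vec ℕ n → ℤ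
  coeff []             e = 0ℤ
  coeff ((c , e′) ∷ p) e =
    (if does (Vec.≡-dec _≟_ e′ e) then c else 0ℤ) ℤ.+ coeff p e

  infix 4 _≈ₚ_
  _≈ₚ_ : Poly n → Poly n → Set
  p ≈ₚ r = ∀ e → coeff p e ≡ coeff r e

  const : ℤ → Poly n
  const c = (c , Vec.replicate n 0) ∷ []

  var : Fin n → Poly n
  var i = (1ℤ , Vec.replicate n 0 [ i ]≔ 1) ∷ []

  infixl 6 _+ₚ_
  _+ₚ_ : Poly n → Poly n → Poly n
  _+ₚ_ = _++_

  infixl 7 _*ₚ_
  _*ₚ_ : Poly n → Poly n → Poly n
  _*ₚ_ = cartesianProductWith λ (c , e) (c′ , e′) → c ℤ.* c′ , Vec.zipWith _+_ e e′

  polyRawSemiring : RawSemiring _ _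
  polyRawSemiring = record
    { Carrier = Poly n
    ; _≈_     = _≈ₚ_
    ; _+_     = _+ₚ_
    ; _*_     = _*ₚ_
    ; 0#      = []
    ; 1#      = const 1ℤ
    }

  open import Algebra.Definitions.RawSemiring polyRawSemiring public
    using () renaming (_^_ to infixr 8 _^ₚ_)

  ∑ₚ : List A → (A → Poly n) → Poly n
  ∑ₚ as f = foldr (λ a p → f a +ₚ p) [] as

------------------------------------------------------------------------
-- Partitions

infix 4 _⊢_
record _⊢_ (lam : List ℕ) (m : ℕ) : Set where
  constructor isPartition
  field
    decreasing : Linked _≥_ lam
    positive   : All (_> 0) lam
    size       : sum lam ≡ m

_⊢?_ : ∀ lam m → Dec (lam ⊢ m)
lam ⊢? m = map′
  (λ (d , p , s) → isPartition d p s)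
  (λ (isPartition d p s) → d , p , s)
  (linked? _≥?_ lam ×-dec all? (_>? 0) lam ×-dec (sum lam ≟ m))

[1⋯_] : ℕ → List ℕ
[1⋯ m ] = applyUpTo suc m

words : List A → ℕ → List (List A)
words as zero    = [] ∷ []
words as (suc k) = cartesianProductWith _∷_ as (words as k)

candidates : ℕ → List (List ℕ)
candidates m = concatMap (words [1⋯ m ]) (upTo (suc m))

-- ∈-partitions and partitions-unique below show that this lists each
-- partition of m exactly once.
partitions : ℕ → List (List ℕ)
partitions m = filter (_⊢? m) (candidates m)

-- The jth part of the conjugate is the number of parts that are at least j,
-- for j from 1 to the largest part.
conjugate : List ℕ → List ℕ
conjugate lam = map (λ j → length (filter (j ≤?_) lam)) [1⋯ foldr _⊔_ 0 lam ]

v : List ℕ → ℕ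
v lam = sum (map ⌊_/2⌋ lam)

-- Only the parts with even index (counting from 1) contribute.
d : List ℕ → ℕ
d (_ ∷ b ∷ lam) = ⌊ b /2⌋ + d lam
d _             = 0

------------------------------------------------------------------------
-- Standard Young tableaux, given as their lists of rows from top to bottom

Tableau : Set
Tableau = List (List ℕ)

readingWord : Tableau → List ℕ
readingWord = concat

-- In a tableau of partition shape a row is never longer than the row above
-- it, so zip drops only the entries of r with no cell beneath them.
Above : List ℕ → List ℕ → Set
Above r s = All (uncurry _<_) (zip r s)

record IsSYT (lam : List ℕ) (T : Tableau) : Set where
  constructor isSYT
  field
    shape   : map length T ≡ lam
    content : readingWord T ↭ [1⋯ sum lam ]
    rows    : All (Linked _<_) T
    columns : Linked Above T

infix 4 _↭?_
_↭?_ : (as bs : List ℕ) → Dec (as ↭ bs)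
[]       ↭? []       = yes ↭-refl
[]       ↭? (_ ∷ _)  = no (¬x∷xs↭[] ∘ ↭-sym)
(a ∷ as) ↭? bs with mem? _≟_ a bs
... | no  a∉bs = no λ p → a∉bs (∈-resp-↭ p (here refl))
... | yes a∈bs with bs₁ , bs₂ , refl ← ∈-∃++ a∈bs = map′
  (λ p → ↭-trans (↭-prep a p) (↭-sym (shift a bs₁ bs₂)))
  (λ p → drop-∷ (↭-trans p (shift a bs₁ bs₂)))
  (as ↭? bs₁ ++ bs₂)

isSYT? : ∀ lam T → Dec (IsSYT lam T)
isSYT? lam T = map′
  (λ (s , c , r , k) → isSYT s c r k)
  (λ (isSYT s c r k) → s , c , r , k)
  (≡-dec _≟_ (map length T) lam
    ×-dec (readingWord T ↭? [1⋯ sum lam ])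
    ×-dec all? (linked? _<?_) T
    ×-dec linked? (λ r s → all? (λ (a , b) → a <? b) (zip r s)) T)

fillings : List ℕ → List ℕ → List Tableau
fillings as []        = [] ∷ []
fillings as (k ∷ lam) = cartesianProductWith _∷_ (words as k) (fillings as lam)

-- ∈-SYT and SYT-unique below show that this lists each standard Young
-- tableau of shape lam exactly once.
SYT : List ℕ → List Tableau
SYT lam = filter (isSYT? lam) (fillings [1⋯ sum lam ] lam)

inversions : List ℕ → ℕ
inversions []      = 0
inversions (a ∷ w) = length (filter (_<? a) w) + inversions w

sign : Tableau → ℤ
sign T = -1ℤ ℤ.^ inversions (readingWord T)

signImbalance : List ℕ → ℤ
signImbalance lam = foldr (λ T s → sign T ℤ.+ s) 0ℤ (SYT lam)

------------------------------------------------------------------------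
-- Correctness of the enumerations

∈-words : ∀ {as : List A} {w} → All (_∈ as) w → w ∈ words as (length w)
∈-words []       = here refl
∈-words (p ∷ ps) = ∈-cartesianProductWith⁺ _∷_ p (∈-words ps)

words-length : ∀ (as : List A) k {w} → w ∈ words as k → length w ≡ k
words-length as zero    (here refl) = refl
words-length as (suc k) w∈
  with _ , _ , _ , u∈ , refl ← ∈-cartesianProductWith⁻ _∷_ as (words as k) w∈
  = cong suc (words-length as k u∈)

words-unique : ∀ {as : List A} → Unique as → ∀ k → Unique (words as k)
words-unique u zero    = [] ∷ []
words-unique u (suc k) =
  Unique.cartesianProductWith⁺ _∷_ ∷-injective u (words-unique u k)

∈-fillings : ∀ {as} T → All (All (_∈ as)) T → T ∈ fillings as (map length T)
∈-fillings []      []       = here refl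
∈-fillings (r ∷ T) (p ∷ ps) = ∈-cartesianProductWith⁺ _∷_ (∈-words p) (∈-fillings T ps)

fillings-unique : ∀ {as} → Unique as → ∀ lam → Unique (fillings as lam)
fillings-unique u []        = [] ∷ []
fillings-unique u (k ∷ lam) =
  Unique.cartesianProductWith⁺ _∷_ ∷-injective (words-unique u k) (fillings-unique u lam)

[1⋯]-unique : ∀ m → Unique [1⋯ m ]
[1⋯]-unique m = Unique.applyUpTo⁺₁ suc m λ i<j _ eq →
  <⇒≢ i<j (suc-injective eq)
  where open import Data.Nat.Properties using (<⇒≢)

∈-[1⋯] : ∀ {a m} → a > 0 → a ≤ m → a ∈ [1⋯ m ]
∈-[1⋯] {suc a} _ a<m = ∈-applyUpTo⁺ suc a<m

part≤sum : ∀ {lam a} → a ∈ lam → a ≤ sum lam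
part≤sum {b ∷ lam} (here refl) = m≤m+n b (sum lam)
part≤sum {b ∷ lam} (there p)   = ≤-trans (part≤sum p) (m≤n+m (sum lam) b)

length≤sum : ∀ {lam} → All (_> 0) lam → length lam ≤ sum lam
length≤sum []       = z≤n
length≤sum (p ∷ ps) = +-mono-≤ p (length≤sum ps)

∈-partitions : ∀ {lam m} → lam ∈ partitions m ⇔ lam ⊢ m
∈-partitions {lam} {m} = mk⇔ (proj₂ ∘ ∈-filter⁻ (_⊢? m) {xs = candidates m}) λ where
  p@(isPartition _ pos refl) → ∈-filter⁺ (_⊢? m)
    (∈-concatMap⁺ (words [1⋯ m ])
      (lose (∈-upTo⁺ (s≤s (length≤sum pos)))
        (∈-words (tabulate λ a∈ → ∈-[1⋯] (lookup pos a∈) (part≤sum a∈)))))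
    p

partitions-unique : ∀ m → Unique (partitions m)
partitions-unique m = Unique.filter⁺ (_⊢? m) (Unique.concat⁺
  (All-map⁺ (universal (words-unique ([1⋯]-unique m)) (upTo (suc m))))
  (AllPairs.map⁺ (AllPairs.map
    (λ k≢l {_} (w∈k , w∈l) → k≢l (trans (sym (words-length [1⋯ m ] _ w∈k)) (words-length [1⋯ m ] _ w∈l)))
    (Unique.upTo⁺ (suc m)))))

∈-SYT : ∀ {lam T} → T ∈ SYT lam ⇔ IsSYT lam T
∈-SYT {lam} {T} = mk⇔ (proj₂ ∘ ∈-filter⁻ (isSYT? lam) {xs = fillings [1⋯ sum lam ] lam}) λ where
  p@(isSYT refl c _ _) → ∈-filter⁺ (isSYT? lam)
    (∈-fillings T (tabulate λ r∈ → tabulate λ a∈ → ∈-resp-↭ c (∈-concat⁺′ a∈ r∈)))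
    p

SYT-unique : ∀ lam → Unique (SYT lam)
SYT-unique lam = Unique.filter⁺ (isSYT? lam) (fillings-unique ([1⋯]-unique (sum lam)) lam)

{-# OPTIONS --safe #-}
module Submission where

open import Defs
open import Data.Bool.Base using (Bool; true; false; not; _∧_; if_then_else_)
open import Data.Fin.Base as Fin using (Fin)
open import Data.Fin.Patterns using (0F; 1F; 2F; 3F)
open import Data.Integer.Base as ℤ using (ℤ; 0ℤ; 1ℤ; -1ℤ)
import Data.Integer.Properties as ℤ
open import Data.Integer.Tactic.RingSolver using (solve-∀)
open import Data.List.Base using
  (List; []; _∷_; _++_; _∷ʳ_; applyUpTo; concat; concatMap; filter; foldr; length; map)
open import Data.List.Membership.DecPropositional using () renaming (_∈?_ to member?)
open import Data.List.Membership.Propositional using (_∈_; find; lose)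
open import Data.List.Membership.Propositional.Properties
open import Data.List.Membership.Propositional.Properties.WithK using (unique∧set⇒bag)
open import Data.List.Properties using
  ( ++-assoc; ++-identityʳ; ∷-injectiveˡ; ∷-injectiveʳ; applyUpTo-∷ʳ; filter-++; filter-all
  ; filter-reject; length-++; length-++-sucʳ; length-applyUpTo; map-applyUpTo )
open import Data.List.Relation.Binary.BagAndSetEquality using (∼bag⇒↭)
open import Data.List.Relation.Binary.Permutation.Propositional
  using (_↭_; ↭-refl; ↭-sym; ↭-trans; ↭-prep; ↭-reflexive)
import Data.List.Relation.Binary.Permutation.Propositional as ↭ using (refl; prep; swap; trans)
import Data.List.Relation.Binary.Permutation.Propositional.Properties as ↭
open import Data.List.Relation.Unary.All as All using (All; []; _∷_)
import Data.List.Relation.Unary.All.Properties as All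
open import Data.List.Relation.Unary.AllPairs as AllPairs using ([]; _∷_)
import Data.List.Relation.Unary.AllPairs.Properties as AllPairs
open import Data.List.Relation.Unary.Any using (here; there)
open import Data.List.Relation.Unary.Linked as Linked using (Linked; []; [-]; _∷_)
open import Data.List.Relation.Unary.Unique.Propositional using (Unique)
import Data.List.Relation.Unary.Unique.Propositional.Properties as Unique
open import Data.Maybe.Base as Maybe using (Maybe; just; nothing)
import Data.Maybe.Relation.Unary.All as Maybe using (All; just; nothing)
open import Data.Nat.Base using
  ( ℕ; zero; suc; pred; _+_; _⊔_; _<_; _≤_; _>_; _≥_; _<ᵇ_; _≡ᵇ_; ⌊_/2⌋; z≤n; s≤s; z<s )
open import Data.Nat.ListAction using (sum)
import Data.Nat.Properties as ℕ
import Data.Nat.Tactic.RingSolver as ℕ-Solver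
open import Data.Product using (_×_; _,_; proj₁; proj₂; ∃-syntax)
open import Data.Sum using (_⊎_; inj₁; inj₂)
open import Data.Vec.Base as Vec using (Vec; []; _∷_; _[_]≔_)
import Data.Vec.Properties as Vec
open import Function.Base using (_∘_; case_of_)
open import Function.Bundles using (_⇔_; mk⇔; Equivalence)
open import Relation.Binary.PropositionalEquality hiding ([_])
open import Relation.Nullary using (does; yes; no; contradiction)

open import Algebra.Properties.CommutativeSemigroup ℕ.+-commutativeSemigroup using (x∙yz≈y∙xz)
  renaming (interchange to ℕ-interchange)
open import Algebra.Properties.CommutativeSemigroup ℤ.+-commutativeSemigroup using ()
  renaming (interchange to ℤ-interchange; x∙yz≈y∙xz to x+yz≡y+xz)
open import Algebra.Properties.CommutativeSemigroup ℤ.*-commutativeSemigroup using ()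
  renaming (x∙yz≈y∙xz to x*yz≡y*xz)

-- Regard the sum over λ as a linear functional of the monomial weight f, a function on
-- partitions. Removing the largest entry of a tableau turns it into the m-th power of the
-- operator ∂ that adds one cell with a sign, applied to f and evaluated at the empty
-- partition. With suitable signs, the operator `shrink` removing one cell satisfies
-- ∂ shrink + shrink ∂ = 1, so ∂² commutes with shrink. In ∂² all cells but dominoes cancel.
-- A horizontal domino fits in row i + 1 exactly when one can be removed from row i, and
-- likewise for vertical dominoes and columns; hence on monomial weights
-- ∂² f = (x + y) f + x² y² q t shrink² f. The last term does not contribute at the empty
-- partition, so each ∂² contributes a factor x + y.

-- Adding and removing cells

-- The weight must be readable row by row, although two exponents involve the conjugate. Pairing
-- consecutive rows shows that v(λ') is the number of cells in even rows and that d(λ') = d(λ) is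
-- the sum of their halved lengths, so q and t always share one exponent. A horizontal domino
-- therefore weighs x in an odd row and x y² q t in an even one; a vertical domino weighs y in an
-- odd column and x² y q t in an even one. Dominoes of the same direction in adjacent rows, or
-- adjacent columns, together weigh x² y² q t: removing one and multiplying by this monomial amounts
-- to adding the other. Vertical signs agree because a vertical domino meets the sign change of
-- `shrink` exactly once. Only the first row and the first column lack a partner, and they supply x
-- and y. The obstacle is recursion over rows: below a row, the first part is limited. So everything
-- is proved under a bound, and the bound breaks the vertical matching in a single column, which
-- `excess` repairs.

infix 8 [_]·_
[_]·_ : Bool → ℤ → ℤ
[ b ]· z = if b then z else 0ℤ

sgn : ℕ → ℤ
sgn n = -1ℤ ℤ.^ n

sgn-suc : ∀ n → sgn (suc n) ≡ ℤ.- sgn n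
sgn-suc n = ℤ.-1*i≡-i (sgn n)

sgn-+ : ∀ m n → sgn (m + n) ≡ sgn m ℤ.* sgn n
sgn-+ = ℤ.^-distribˡ-+-* -1ℤ

sgn² : ∀ n → sgn n ℤ.* sgn n ≡ 1ℤ
sgn² zero = refl
sgn² (suc n) rewrite sgn-suc n = trans (square-neg (sgn n)) (sgn² n)
  where
  square-neg : ∀ s → ℤ.- s ℤ.* (ℤ.- s) ≡ s ℤ.* s
  square-neg = solve-∀

sgn-cancel : ∀ n z → sgn n ℤ.* (sgn n ℤ.* z) ≡ z
sgn-cancel n z = begin
  sgn n ℤ.* (sgn n ℤ.* z) ≡⟨ ℤ.*-assoc (sgn n) (sgn n) z ⟨
  sgn n ℤ.* sgn n ℤ.* z   ≡⟨ cong (ℤ._* z) (sgn² n) ⟩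
  1ℤ ℤ.* z                ≡⟨ ℤ.*-identityˡ z ⟩
  z                       ∎
  where open ≡-Reasoning

-- An upper bound for the first part, where nothing stands for infinity.
Bound : Set
Bound = Maybe ℕ

room : Bound → ℕ → Bool
room nothing  a = true
room (just n) a = a <ᵇ n

infixr 5 _⊙_
_⊙_ : ℕ → List ℕ → List ℕ
zero  ⊙ μ = []
suc a ⊙ μ = suc a ∷ μ

first : List ℕ → ℕ
first []      = 0
first (a ∷ _) = a

-- Partitions with first part at most N: room N a says that a + 1 ≤ N.
data Par (N : Bound) : List ℕ → Set where
  []  : Par N []
  _∷_ : ∀ {a μ} → room N a ≡ true → Par (just (suc a)) μ → Par N (suc a ∷ μ)

-- The sign is that of moving the new, largest entry past the cells below it.
grow : Bound → (List ℕ → ℤ) → List ℕ → ℤ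
grow N f []      = [ room N 0 ]· f (1 ∷ [])
grow N f (a ∷ μ) =
  [ room N a ]· (sgn (sum μ) ℤ.* f (suc a ∷ μ)) ℤ.+ grow (just a) (f ∘ (a ∷_)) μ

-- The sign is that of grow, changed in every second row.
shrink : (List ℕ → ℤ) → List ℕ → ℤ
shrink f []      = 0ℤ
shrink f (a ∷ μ) =
  [ first μ <ᵇ a ]· (sgn (sum μ) ℤ.* f (pred a ⊙ μ)) ℤ.- shrink (f ∘ (a ∷_)) μ

grow-ext : ∀ N {f g} → f ≗ g → grow N f ≗ grow N g
grow-ext N p []      = cong ([ room N 0 ]·_) (p _)
grow-ext N p (a ∷ μ) = cong₂ ℤ._+_
  (cong (λ z → [ room N a ]· (sgn (sum μ) ℤ.* z)) (p _))
  (grow-ext (just a) (λ κ → p (a ∷ κ)) μ)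

shrink-ext : ∀ {f g} → f ≗ g → shrink f ≗ shrink g
shrink-ext p []      = refl
shrink-ext p (a ∷ μ) = cong₂ ℤ._-_
  (cong (λ z → [ first μ <ᵇ a ]· (sgn (sum μ) ℤ.* z)) (p _))
  (shrink-ext (λ κ → p (a ∷ κ)) μ)

room-pred : ∀ N a → room N (suc a) ≡ true → room N a ≡ true
room-pred nothing  a       _ = refl
room-pred (just (suc n)) zero    p = refl
room-pred (just (suc n)) (suc a) p = room-pred (just n) a p

<ᵇ-suc-mono : ∀ a n → (a <ᵇ n) ≡ true → (a <ᵇ suc n) ≡ true
<ᵇ-suc-mono zero    n       p = refl
<ᵇ-suc-mono (suc a) (suc n) p = <ᵇ-suc-mono a n p

Par-suc : ∀ {a μ} → Par (just a) μ → Par (just (suc a)) μ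
Par-suc []      = []
Par-suc (_∷_ {b} p q) = <ᵇ-suc-mono b _ p ∷ q

-- Unlike `grow-ext`, this asks for agreement at partitions only, which is all that identities such
-- as `∂-shrink` provide.
grow-cong : ∀ {N μ f g} → Par N μ → (∀ {κ} → Par N κ → f κ ≡ g κ) → grow N f μ ≡ grow N g μ
grow-cong {N} [] p with room N 0 in eq
... | true  = p (eq ∷ [])
... | false = refl
grow-cong {N} {suc a ∷ μ} (r ∷ q) p = cong₂ ℤ._+_ head (grow-cong q (λ k → p (r ∷ k)))
  where
  head : [ room N (suc a) ]· (sgn (sum μ) ℤ.* _) ≡ [ room N (suc a) ]· (sgn (sum μ) ℤ.* _)
  head with room N (suc a) in eq
  ... | true  = cong (sgn (sum μ) ℤ.*_) (p (eq ∷ Par-suc q))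
  ... | false = refl

[]·-+ : ∀ b z w → [ b ]· (z ℤ.+ w) ≡ [ b ]· z ℤ.+ [ b ]· w
[]·-+ true  z w = refl
[]·-+ false z w = refl

[]·-* : ∀ b c z → [ b ]· (c ℤ.* z) ≡ c ℤ.* [ b ]· z
[]·-* true  c z = refl
[]·-* false c z = sym (ℤ.*-zeroʳ c)

grow-+ : ∀ N f g μ → grow N (λ κ → f κ ℤ.+ g κ) μ ≡ grow N f μ ℤ.+ grow N g μ
grow-+ N f g []      = []·-+ (room N 0) _ _
grow-+ N f g (a ∷ μ) = begin
  [ r ]· (s ℤ.* (f (suc a ∷ μ) ℤ.+ g (suc a ∷ μ))) ℤ.+ grow (just a) (λ κ → f (a ∷ κ) ℤ.+ g (a ∷ κ)) μ
    ≡⟨ cong₂ ℤ._+_ (trans (cong ([ r ]·_) (ℤ.*-distribˡ-+ s _ _)) ([]·-+ r _ _)) (grow-+ (just a) _ _ μ) ⟩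
  _ ≡⟨ ℤ-interchange ([ r ]· (s ℤ.* f (suc a ∷ μ))) _ _ _ ⟩
  grow N f (a ∷ μ) ℤ.+ grow N g (a ∷ μ) ∎
  where
  open ≡-Reasoning
  r = room N a
  s = sgn (sum μ)

grow-* : ∀ N c f μ → grow N (λ κ → c ℤ.* f κ) μ ≡ c ℤ.* grow N f μ
grow-* N c f []      = []·-* (room N 0) c _
grow-* N c f (a ∷ μ) = begin
  [ r ]· (s ℤ.* (c ℤ.* f (suc a ∷ μ))) ℤ.+ grow (just a) (λ κ → c ℤ.* f (a ∷ κ)) μ
    ≡⟨ cong₂ ℤ._+_ (trans (cong ([ r ]·_) (x*yz≡y*xz s c _)) ([]·-* r c _)) (grow-* (just a) c _ μ) ⟩
  c ℤ.* [ r ]· (s ℤ.* f (suc a ∷ μ)) ℤ.+ c ℤ.* grow (just a) (f ∘ (a ∷_)) μ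
    ≡⟨ ℤ.*-distribˡ-+ c ([ r ]· (s ℤ.* f (suc a ∷ μ))) _ ⟨
  c ℤ.* grow N f (a ∷ μ) ∎
  where
  open ≡-Reasoning
  r = room N a
  s = sgn (sum μ)

grow-0 : ∀ N μ → grow N (λ _ → 0ℤ) μ ≡ 0ℤ
grow-0 N μ = trans (grow-* N 0ℤ (λ _ → 0ℤ) μ) (ℤ.*-zeroˡ (grow N (λ _ → 0ℤ) μ))

grow-neg : ∀ N f μ → grow N (λ κ → ℤ.- f κ) μ ≡ ℤ.- grow N f μ
grow-neg N f μ = begin
  grow N (λ κ → ℤ.- f κ) μ        ≡⟨ grow-ext N (λ κ → ℤ.-1*i≡-i (f κ)) μ ⟨
  grow N (λ κ → -1ℤ ℤ.* f κ) μ    ≡⟨ grow-* N -1ℤ f μ ⟩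
  -1ℤ ℤ.* grow N f μ              ≡⟨ ℤ.-1*i≡-i _ ⟩
  ℤ.- grow N f μ                  ∎
  where open ≡-Reasoning

shrink-* : ∀ c f μ → shrink (λ κ → c ℤ.* f κ) μ ≡ c ℤ.* shrink f μ
shrink-* c f []      = sym (ℤ.*-zeroʳ c)
shrink-* c f (a ∷ μ) = begin
  [ r ]· (s ℤ.* (c ℤ.* f (pred a ⊙ μ))) ℤ.- shrink (λ κ → c ℤ.* f (a ∷ κ)) μ
    ≡⟨ cong₂ ℤ._-_ (trans (cong ([ r ]·_) (x*yz≡y*xz s c _)) ([]·-* r c _)) (shrink-* c _ μ) ⟩
  c ℤ.* [ r ]· (s ℤ.* f (pred a ⊙ μ)) ℤ.- c ℤ.* shrink (f ∘ (a ∷_)) μ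
    ≡⟨ factor c ([ r ]· (s ℤ.* f (pred a ⊙ μ))) _ ⟩
  c ℤ.* shrink f (a ∷ μ) ∎
  where
  open ≡-Reasoning
  r = first μ <ᵇ a
  s = sgn (sum μ)
  factor : ∀ c z w → c ℤ.* z ℤ.- c ℤ.* w ≡ c ℤ.* (z ℤ.- w)
  factor = solve-∀

shrink-+ : ∀ f g μ → shrink (λ κ → f κ ℤ.+ g κ) μ ≡ shrink f μ ℤ.+ shrink g μ
shrink-+ f g []      = refl
shrink-+ f g (a ∷ μ) = begin
  [ r ]· (s ℤ.* (f (pred a ⊙ μ) ℤ.+ g (pred a ⊙ μ))) ℤ.- shrink (λ κ → f (a ∷ κ) ℤ.+ g (a ∷ κ)) μ
    ≡⟨ cong₂ ℤ._-_ (trans (cong ([ r ]·_) (ℤ.*-distribˡ-+ s _ _)) ([]·-+ r _ _)) (shrink-+ _ _ μ) ⟩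
  _ ≡⟨ regroup ([ r ]· (s ℤ.* f (pred a ⊙ μ))) _ _ _ ⟩
  shrink f (a ∷ μ) ℤ.+ shrink g (a ∷ μ) ∎
  where
  open ≡-Reasoning
  r = first μ <ᵇ a
  s = sgn (sum μ)
  regroup : ∀ a b c d → (a ℤ.+ b) ℤ.- (c ℤ.+ d) ≡ (a ℤ.- c) ℤ.+ (b ℤ.- d)
  regroup = solve-∀

-- grow and shrink change the size by one, so the parity of the size anticommutes with them.
grow-sgn : ∀ N f μ → grow N (λ κ → sgn (sum κ) ℤ.* f κ) μ ≡ ℤ.- (sgn (sum μ) ℤ.* grow N f μ)
grow-sgn N f []      with room N 0
... | true  = trans (ℤ.-1*i≡-i x) (cong ℤ.-_ (sym (ℤ.*-identityˡ x)))
  where x = f (1 ∷ [])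
... | false = refl
grow-sgn N f (a ∷ μ) = begin
  [ r ]· (s ℤ.* (sgn (suc a + sum μ) ℤ.* x)) ℤ.+ grow (just a) (λ κ → sgn (a + sum κ) ℤ.* f (a ∷ κ)) μ
    ≡⟨ cong₂ ℤ._+_
         (trans (cong (λ z → [ r ]· (s ℤ.* (z ℤ.* x))) (trans (sgn-suc (a + sum μ)) (cong ℤ.-_ (sgn-+ a (sum μ)))))
           (trans (cong ([ r ]·_) (swap s t x)) ([]·-* r (ℤ.- (t ℤ.* s)) _)))
         (trans (grow-ext (just a) (λ κ → trans (cong (ℤ._* f (a ∷ κ)) (sgn-+ a (sum κ))) (ℤ.*-assoc t _ _)) μ)
           (trans (grow-* (just a) t _ μ) (cong (t ℤ.*_) (grow-sgn (just a) _ μ)))) ⟩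
  ℤ.- (t ℤ.* s) ℤ.* [ r ]· (s ℤ.* x) ℤ.+ t ℤ.* (ℤ.- (s ℤ.* y))
    ≡⟨ collect t s ([ r ]· (s ℤ.* x)) y ⟩
  ℤ.- ((t ℤ.* s) ℤ.* ([ r ]· (s ℤ.* x) ℤ.+ y))
    ≡⟨ cong (λ z → ℤ.- (z ℤ.* ([ r ]· (s ℤ.* x) ℤ.+ y))) (sgn-+ a (sum μ)) ⟨
  ℤ.- (sgn (a + sum μ) ℤ.* grow N f (a ∷ μ)) ∎
  where
  open ≡-Reasoning
  r = room N a
  s = sgn (sum μ)
  t = sgn a
  x = f (suc a ∷ μ)
  y = grow (just a) (f ∘ (a ∷_)) μ
  swap : ∀ s t x → s ℤ.* (ℤ.- (t ℤ.* s) ℤ.* x) ≡ ℤ.- (t ℤ.* s) ℤ.* (s ℤ.* x)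
  swap = solve-∀
  collect : ∀ t s u y → ℤ.- (t ℤ.* s) ℤ.* u ℤ.+ t ℤ.* (ℤ.- (s ℤ.* y)) ≡ ℤ.- ((t ℤ.* s) ℤ.* (u ℤ.+ y))
  collect = solve-∀

⊙-size : ∀ {a μ} → Par (just (suc a)) μ → (first μ <ᵇ suc a) ≡ true → sum (a ⊙ μ) ≡ a + sum μ
⊙-size {suc a} _       _ = refl
⊙-size {zero}  []      _ = refl
⊙-size {zero}  (_ ∷ _) ()

shrink-sgn : ∀ {N μ} f → Par N μ → shrink (λ κ → sgn (sum κ) ℤ.* f κ) μ ≡ ℤ.- (sgn (sum μ) ℤ.* shrink f μ)
shrink-sgn f [] = refl
shrink-sgn {μ = suc a ∷ μ} f (_ ∷ p) = begin
  [ r ]· (s ℤ.* (sgn (sum (a ⊙ μ)) ℤ.* x)) ℤ.- shrink (λ κ → sgn (suc a + sum κ) ℤ.* f (suc a ∷ κ)) μ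
    ≡⟨ cong₂ ℤ._-_ head
         (trans (shrink-ext (λ κ → trans (cong (ℤ._* f (suc a ∷ κ)) (sgn-+ (suc a) (sum κ))) (ℤ.*-assoc t _ _)) μ)
           (trans (shrink-* t _ μ) (cong (t ℤ.*_) (shrink-sgn _ p)))) ⟩
  ℤ.- (t ℤ.* s) ℤ.* [ r ]· (s ℤ.* x) ℤ.- t ℤ.* (ℤ.- (s ℤ.* y))
    ≡⟨ collect t s ([ r ]· (s ℤ.* x)) y ⟩
  ℤ.- ((t ℤ.* s) ℤ.* ([ r ]· (s ℤ.* x) ℤ.- y))
    ≡⟨ cong (λ z → ℤ.- (z ℤ.* ([ r ]· (s ℤ.* x) ℤ.- y))) (sgn-+ (suc a) (sum μ)) ⟨
  ℤ.- (sgn (suc a + sum μ) ℤ.* shrink f (suc a ∷ μ)) ∎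
  where
  open ≡-Reasoning
  r = first μ <ᵇ suc a
  s = sgn (sum μ)
  t = sgn (suc a)
  x = f (a ⊙ μ)
  y = shrink (f ∘ (suc a ∷_)) μ
  swap : ∀ s t x → s ℤ.* (t ℤ.* s ℤ.* x) ≡ ℤ.- (ℤ.- t ℤ.* s) ℤ.* (s ℤ.* x)
  swap = solve-∀
  collect : ∀ t s u y → ℤ.- (t ℤ.* s) ℤ.* u ℤ.- t ℤ.* (ℤ.- (s ℤ.* y)) ≡ ℤ.- ((t ℤ.* s) ℤ.* (u ℤ.- y))
  collect = solve-∀
  head : [ r ]· (s ℤ.* (sgn (sum (a ⊙ μ)) ℤ.* x)) ≡ ℤ.- (t ℤ.* s) ℤ.* [ r ]· (s ℤ.* x)
  head with first μ <ᵇ suc a in eq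
  ... | false = sym (ℤ.*-zeroʳ (ℤ.- (t ℤ.* s)))
  ... | true  = begin
    s ℤ.* (sgn (sum (a ⊙ μ)) ℤ.* x)     ≡⟨ cong (λ n → s ℤ.* (sgn n ℤ.* x)) (⊙-size p eq) ⟩
    s ℤ.* (sgn (a + sum μ) ℤ.* x)       ≡⟨ cong (λ z → s ℤ.* (z ℤ.* x)) (sgn-+ a (sum μ)) ⟩
    s ℤ.* (sgn a ℤ.* s ℤ.* x)           ≡⟨ swap s (sgn a) x ⟩
    ℤ.- (ℤ.- sgn a ℤ.* s) ℤ.* (s ℤ.* x) ≡⟨ cong (λ z → ℤ.- (z ℤ.* s) ℤ.* (s ℤ.* x)) (sgn-suc a) ⟨
    ℤ.- (t ℤ.* s) ℤ.* (s ℤ.* x)         ∎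

<ᵇ-suc : ∀ a → (a <ᵇ suc a) ≡ true
<ᵇ-suc zero    = refl
<ᵇ-suc (suc a) = <ᵇ-suc a

first-bounded : ∀ {n μ} → Par (just n) μ → (first μ <ᵇ suc n) ≡ true
first-bounded []      = refl
first-bounded (p ∷ _) = p

[]·-0 : ∀ b → [ b ]· 0ℤ ≡ 0ℤ
[]·-0 true  = refl
[]·-0 false = refl

-- Adding a cell below and removing the end of the row above: the two orders have opposite signs.
grow-shorten : ∀ {a μ} f → Par (just (suc a)) μ →
  grow (just (suc a)) (λ κ → [ first κ <ᵇ suc a ]· (sgn (sum κ) ℤ.* f (a ⊙ κ))) μ
    ≡ ℤ.- ([ first μ <ᵇ suc a ]· (sgn (sum μ) ℤ.* grow (just a) (f ∘ (a ∷_)) μ))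
grow-shorten {zero}  {[]} f [] = refl
grow-shorten {suc a} {[]} f [] = trans (ℤ.-1*i≡-i x) (cong ℤ.-_ (sym (ℤ.*-identityˡ x)))
  where x = f (suc a ∷ 1 ∷ [])
grow-shorten {a} {suc b ∷ ν} f (r ∷ p) with b <ᵇ a in eq
... | false = trans (ℤ.+-identityˡ _) (grow-0 (just (suc b)) ν)
grow-shorten {suc a} {suc b ∷ ν} f (r ∷ p) | true = begin
  s ℤ.* [ b <ᵇ a ]· (sgn (suc (suc b) + sum ν) ℤ.* x) ℤ.+ grow (just (suc b)) (λ κ → sgn (suc b + sum κ) ℤ.* g κ) ν
    ≡⟨ cong₂ ℤ._+_
        (trans (cong (s ℤ.*_) (trans ([]·-* (b <ᵇ a) (sgn (suc (suc b) + sum ν)) x) (cong (ℤ._* [ b <ᵇ a ]· x) (sgn-suc (suc b + sum ν)))))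
          (trans (swap s (sgn (suc b + sum ν)) _) (cong (ℤ.- sgn (suc b + sum ν) ℤ.*_) (sym ([]·-* (b <ᵇ a) s x)))))
        tail ⟩
  ℤ.- sgn (suc b + sum ν) ℤ.* [ b <ᵇ a ]· (s ℤ.* x) ℤ.+ ℤ.- (sgn (suc b + sum ν) ℤ.* y)
    ≡⟨ collect (sgn (suc b + sum ν)) ([ b <ᵇ a ]· (s ℤ.* x)) y ⟩
  ℤ.- (sgn (suc b + sum ν) ℤ.* ([ b <ᵇ a ]· (s ℤ.* x) ℤ.+ y)) ∎
  where
  open ≡-Reasoning
  s = sgn (sum ν)
  x = f (suc a ∷ suc (suc b) ∷ ν)
  g = λ κ → f (suc a ∷ suc b ∷ κ)
  y = grow (just (suc b)) g ν
  swap : ∀ s t x → s ℤ.* (ℤ.- t ℤ.* x) ≡ ℤ.- t ℤ.* (s ℤ.* x)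
  swap = solve-∀
  collect : ∀ t u y → ℤ.- t ℤ.* u ℤ.+ ℤ.- (t ℤ.* y) ≡ ℤ.- (t ℤ.* (u ℤ.+ y))
  collect = solve-∀
  move : ∀ t s y → t ℤ.* ℤ.- (s ℤ.* y) ≡ ℤ.- (t ℤ.* s ℤ.* y)
  move = solve-∀
  tail : grow (just (suc b)) (λ κ → sgn (suc b + sum κ) ℤ.* g κ) ν ≡ ℤ.- (sgn (suc b + sum ν) ℤ.* y)
  tail = begin
    grow (just (suc b)) (λ κ → sgn (suc b + sum κ) ℤ.* g κ) ν
      ≡⟨ grow-ext _ (λ κ → trans (cong (ℤ._* g κ) (sgn-+ (suc b) (sum κ))) (ℤ.*-assoc (sgn (suc b)) _ _)) ν ⟩
    grow (just (suc b)) (λ κ → sgn (suc b) ℤ.* (sgn (sum κ) ℤ.* g κ)) ν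
      ≡⟨ grow-* _ (sgn (suc b)) _ ν ⟩
    sgn (suc b) ℤ.* grow (just (suc b)) (λ κ → sgn (sum κ) ℤ.* g κ) ν
      ≡⟨ cong (sgn (suc b) ℤ.*_) (grow-sgn _ g ν) ⟩
    sgn (suc b) ℤ.* ℤ.- (s ℤ.* y)
      ≡⟨ move (sgn (suc b)) s y ⟩
    ℤ.- (sgn (suc b) ℤ.* s ℤ.* y)
      ≡⟨ cong (λ z → ℤ.- (z ℤ.* y)) (sgn-+ (suc b) (sum ν)) ⟨
    ℤ.- (sgn (suc b + sum ν) ℤ.* y) ∎

-- All off-diagonal terms cancel; the diagonal ones telescope, because a cell can be added to
-- row i + 1 exactly when one can be removed from row i.
anticommute : ∀ {N μ} f → room N 0 ≡ true → Par N μ →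
  grow N (shrink f) μ ℤ.+ shrink (grow N f) μ ≡ [ room N (first μ) ]· f μ
anticommute {N} f r [] rewrite r = unit (f [])
  where
  unit : ∀ x → (1ℤ ℤ.* x ℤ.- 0ℤ) ℤ.+ 0ℤ ≡ x
  unit = solve-∀
anticommute {N} {suc a ∷ μ} f r₀ (r ∷ p) = begin
  ([ R ]· (s ℤ.* ([ first μ <ᵇ suc (suc a) ]· (s ℤ.* x) ℤ.- A)) ℤ.+ grow (just (suc a)) (λ κ → shrink f (suc a ∷ κ)) μ)
    ℤ.+ ([ T ]· (s ℤ.* grow N f (a ⊙ μ)) ℤ.- shrink (λ κ → grow N f (suc a ∷ κ)) μ)
    ≡⟨ cong₂ ℤ._+_ (cong₂ ℤ._+_ upper growLower) (cong₂ ℤ._-_ shrinkUpper shrinkLower) ⟩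
  (([ R ]· x ℤ.- [ R ]· (s ℤ.* A)) ℤ.+ (ℤ.- C ℤ.- G))
    ℤ.+ (([ T ]· x ℤ.+ C) ℤ.- (ℤ.- [ R ]· (s ℤ.* A) ℤ.+ H))
    ≡⟨ cancel ([ R ]· x) ([ R ]· (s ℤ.* A)) C G ([ T ]· x) H ⟩
  [ R ]· x ℤ.+ ([ T ]· x ℤ.- (G ℤ.+ H))
    -- The tail is bounded by the row above it, so its diagonal term carries the guard `T`. It
    -- cancels the term of removing the end of the first row and putting it back.
    ≡⟨ cong (λ z → [ R ]· x ℤ.+ ([ T ]· x ℤ.- z)) (anticommute (f ∘ (suc a ∷_)) refl p) ⟩
  [ R ]· x ℤ.+ ([ T ]· x ℤ.- [ T ]· x)
    ≡⟨ cong (λ z → [ R ]· x ℤ.+ z) (ℤ.+-inverseʳ ([ T ]· x)) ⟩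
  [ R ]· x ℤ.+ 0ℤ
    ≡⟨ ℤ.+-identityʳ _ ⟩
  [ R ]· x ∎
  where
  open ≡-Reasoning
  R = room N (suc a)
  T = first μ <ᵇ suc a
  s = sgn (sum μ)
  x = f (suc a ∷ μ)
  A = shrink (f ∘ (suc (suc a) ∷_)) μ
  C = [ T ]· (s ℤ.* grow (just a) (f ∘ (a ∷_)) μ)
  G = grow (just (suc a)) (shrink (f ∘ (suc a ∷_))) μ
  H = shrink (grow (just (suc a)) (f ∘ (suc a ∷_))) μ

  cancel : ∀ u v C G t H → ((u ℤ.- v) ℤ.+ (ℤ.- C ℤ.- G)) ℤ.+ ((t ℤ.+ C) ℤ.- (ℤ.- v ℤ.+ H)) ≡ u ℤ.+ (t ℤ.- (G ℤ.+ H))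
  cancel = solve-∀
  distr : ∀ s u w → s ℤ.* (u ℤ.- w) ≡ s ℤ.* u ℤ.+ ℤ.- (s ℤ.* w)
  distr = solve-∀

  []·-neg : ∀ b z → [ b ]· (ℤ.- z) ≡ ℤ.- [ b ]· z
  []·-neg true  z = refl
  []·-neg false z = refl

  upper : [ R ]· (s ℤ.* ([ first μ <ᵇ suc (suc a) ]· (s ℤ.* x) ℤ.- A)) ≡ [ R ]· x ℤ.- [ R ]· (s ℤ.* A)
  upper = begin
    [ R ]· (s ℤ.* ([ first μ <ᵇ suc (suc a) ]· (s ℤ.* x) ℤ.- A))
      ≡⟨ cong (λ b → [ R ]· (s ℤ.* ([ b ]· (s ℤ.* x) ℤ.- A))) (first-bounded p) ⟩
    [ R ]· (s ℤ.* (s ℤ.* x ℤ.- A))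
      ≡⟨ cong ([ R ]·_) (distr s (s ℤ.* x) A) ⟩
    [ R ]· (s ℤ.* (s ℤ.* x) ℤ.+ ℤ.- (s ℤ.* A))
      ≡⟨ []·-+ R _ _ ⟩
    [ R ]· (s ℤ.* (s ℤ.* x)) ℤ.+ [ R ]· (ℤ.- (s ℤ.* A))
      ≡⟨ cong₂ ℤ._+_ (cong ([ R ]·_) (sgn-cancel (sum μ) x)) ([]·-neg R _) ⟩
    [ R ]· x ℤ.- [ R ]· (s ℤ.* A) ∎

  growLower : grow (just (suc a)) (λ κ → shrink f (suc a ∷ κ)) μ ≡ ℤ.- C ℤ.- G
  growLower = trans (grow-+ (just (suc a)) _ _ μ)
    (cong₂ ℤ._+_ (grow-shorten f p) (grow-neg (just (suc a)) _ μ))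

  grow-⊙ : T ≡ true → grow N f (a ⊙ μ) ≡ s ℤ.* x ℤ.+ grow (just a) (f ∘ (a ∷_)) μ
  grow-⊙ t = go a p t r
    where
    go : ∀ a {μ} → Par (just (suc a)) μ → (first μ <ᵇ suc a) ≡ true → room N a ≡ true →
      grow N f (a ⊙ μ) ≡ sgn (sum μ) ℤ.* f (suc a ∷ μ) ℤ.+ grow (just a) (f ∘ (a ∷_)) μ
    go (suc a) _ _ r rewrite r = refl
    go zero [] _ r rewrite r = sym (trans (ℤ.+-identityʳ _) (ℤ.*-identityˡ (f (1 ∷ []))))
    go zero (_ ∷ _) ()

  shrinkUpper : [ T ]· (s ℤ.* grow N f (a ⊙ μ)) ≡ [ T ]· x ℤ.+ C
  shrinkUpper with first μ <ᵇ suc a in eq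
  ... | false = refl
  ... | true  = trans (cong (s ℤ.*_) (grow-⊙ eq))
    (trans (ℤ.*-distribˡ-+ s _ _) (cong (ℤ._+ s ℤ.* grow (just a) (f ∘ (a ∷_)) μ) (sgn-cancel (sum μ) x)))

  shrinkLower : shrink (λ κ → grow N f (suc a ∷ κ)) μ ≡ ℤ.- [ R ]· (s ℤ.* A) ℤ.+ H
  shrinkLower = trans (shrink-+ _ _ μ) (cong (ℤ._+ H) lift)
    where
    lift : shrink (λ κ → [ R ]· (sgn (sum κ) ℤ.* f (suc (suc a) ∷ κ))) μ ≡ ℤ.- [ R ]· (s ℤ.* A)
    lift with room N (suc a)
    ... | true  = shrink-sgn _ p
    ... | false = trans (shrink-* 0ℤ (λ _ → 0ℤ) μ) (ℤ.*-zeroˡ (shrink (λ _ → 0ℤ) μ))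

Par-⊙ : ∀ {N a μ} → room N a ≡ true → Par (just (suc a)) μ → (first μ <ᵇ suc a) ≡ true → Par N (a ⊙ μ)
Par-⊙ {a = zero}  r p t = []
Par-⊙ {N} {suc a} r [] t = room-pred N a r ∷ []
Par-⊙ {N} {suc a} r (_ ∷ q) t = room-pred N a r ∷ t ∷ q

shrink-cong : ∀ {N μ f g} → Par N μ → (∀ {κ} → Par N κ → f κ ≡ g κ) → shrink f μ ≡ shrink g μ
shrink-cong [] h = refl
shrink-cong {N} {suc a ∷ μ} (r ∷ p) h = cong₂ ℤ._-_ head (shrink-cong p (λ q → h (r ∷ q)))
  where
  head : [ first μ <ᵇ suc a ]· (sgn (sum μ) ℤ.* _) ≡ [ first μ <ᵇ suc a ]· (sgn (sum μ) ℤ.* _)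
  head with first μ <ᵇ suc a in eq
  ... | true  = cong (sgn (sum μ) ℤ.*_) (h (Par-⊙ r p eq))
  ... | false = refl

-- Powers of the signed growth operator

∂ : (List ℕ → ℤ) → List ℕ → ℤ
∂ = grow nothing

-- The innermost `∂` adds the last cell, the one that holds the largest entry of a tableau.
∂^ : ℕ → (List ℕ → ℤ) → List ℕ → ℤ
∂^ zero    f = f
∂^ (suc m) f = ∂^ m (∂ f)

∂^-cong : ∀ m {f g} → (∀ {κ} → Par nothing κ → f κ ≡ g κ) → ∂^ m f [] ≡ ∂^ m g []
∂^-cong zero    h = h []
∂^-cong (suc m) h = ∂^-cong m (λ p → grow-cong p h)

∂^-+ : ∀ m f g → ∂^ m (λ κ → f κ ℤ.+ g κ) [] ≡ ∂^ m f [] ℤ.+ ∂^ m g []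
∂^-+ zero    f g = refl
∂^-+ (suc m) f g = trans (∂^-cong m (λ {κ} _ → grow-+ nothing f g κ)) (∂^-+ m (∂ f) (∂ g))

∂-shrink : ∀ {μ} f → Par nothing μ → ∂ (shrink f) μ ≡ f μ ℤ.- shrink (∂ f) μ
∂-shrink {μ} f p = trans (isolate (∂ (shrink f) μ) _) (cong (ℤ._- shrink (∂ f) μ) (anticommute f refl p))
  where
  isolate : ∀ a b → a ≡ (a ℤ.+ b) ℤ.- b
  isolate = solve-∀

∂²-shrink : ∀ {μ} f → Par nothing μ → ∂ (∂ (shrink f)) μ ≡ shrink (∂ (∂ f)) μ
∂²-shrink {μ} f p = begin
  ∂ (∂ (shrink f)) μ                         ≡⟨ grow-cong p (∂-shrink f) ⟩
  ∂ (λ κ → f κ ℤ.- shrink (∂ f) κ) μ         ≡⟨ grow-+ nothing f _ μ ⟩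
  ∂ f μ ℤ.+ ∂ (λ κ → ℤ.- shrink (∂ f) κ) μ   ≡⟨ cong (λ z → ∂ f μ ℤ.+ z) (grow-neg nothing _ μ) ⟩
  ∂ f μ ℤ.- ∂ (shrink (∂ f)) μ               ≡⟨ cong (λ z → ∂ f μ ℤ.- z) (∂-shrink (∂ f) p) ⟩
  ∂ f μ ℤ.- (∂ f μ ℤ.- shrink (∂ (∂ f)) μ)   ≡⟨ cancel (∂ f μ) _ ⟩
  shrink (∂ (∂ f)) μ                         ∎
  where
  open ≡-Reasoning
  cancel : ∀ a b → a ℤ.- (a ℤ.- b) ≡ b
  cancel = solve-∀

-- Moving `∂` past `shrink` two at a time leaves at most one `∂`, hence a partition with at most one
-- cell, from which two cells cannot be removed. For odd `m` a single `shrink` would not vanish.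
∂^-shrink² : ∀ m f → ∂^ m (shrink (shrink f)) [] ≡ 0ℤ
∂^-shrink² zero          f = refl
∂^-shrink² (suc zero)    f = refl
∂^-shrink² (suc (suc m)) f = trans
  (∂^-cong m (λ p → trans (∂²-shrink (shrink f) p) (shrink-cong p (∂²-shrink f))))
  (∂^-shrink² m (∂ (∂ f)))

-- Dominoes in the squares of `grow` and `shrink`

-- A vertical domino in the first two rows, which have lengths a and b in stack (adding it) and
-- a + 1 and b in unstack (removing it).
stack : (List ℕ → ℤ) → ℕ → List ℕ → ℤ
stack f a []      = 0ℤ
stack f a (b ∷ ν) = [ b ≡ᵇ a ]· (sgn b ℤ.* f (suc a ∷ suc b ∷ ν))

unstack : (List ℕ → ℤ) → ℕ → List ℕ → ℤ
unstack f a []      = 0ℤ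
unstack f a (b ∷ ν) = [ (b ≡ᵇ suc a) ∧ (first ν <ᵇ b) ]· (sgn b ℤ.* f (a ⊙ (pred b ⊙ ν)))

<ᵇ-cases : ∀ b a → (b <ᵇ suc a) ≡ true → ∀ z → [ b <ᵇ suc a ]· z ≡ [ b <ᵇ a ]· z ℤ.+ [ b ≡ᵇ a ]· z
<ᵇ-cases zero    zero    _ z = sym (ℤ.+-identityˡ z)
<ᵇ-cases zero    (suc a) _ z = sym (ℤ.+-identityʳ z)
<ᵇ-cases (suc b) (suc a) p z = <ᵇ-cases b a p z
<ᵇ-cases (suc b) zero    () z

-- A longer row above permits exactly one further move: lengthening a next row of length `suc a`,
-- which completes a vertical domino. Both new cells pass the rows below the domino, so those signs
-- cancel and only the length of the lower row counts.
grow-raise : ∀ {a μ} g → Par (just (suc a)) μ →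
  sgn (sum μ) ℤ.* grow (just (suc (suc a))) (g ∘ (suc (suc a) ∷_)) μ
    ≡ sgn (sum μ) ℤ.* grow (just (suc a)) (g ∘ (suc (suc a) ∷_)) μ ℤ.+ stack g (suc a) μ
grow-raise g [] = sym (ℤ.+-identityʳ _)
grow-raise {a} {suc b ∷ ν} g (r ∷ p) = begin
  t ℤ.* ([ b <ᵇ suc a ]· (s ℤ.* x) ℤ.+ y)
    ≡⟨ cong (λ z → t ℤ.* (z ℤ.+ y)) (<ᵇ-cases b a r (s ℤ.* x)) ⟩
  t ℤ.* (([ b <ᵇ a ]· (s ℤ.* x) ℤ.+ [ b ≡ᵇ a ]· (s ℤ.* x)) ℤ.+ y)
    ≡⟨ split t ([ b <ᵇ a ]· (s ℤ.* x)) ([ b ≡ᵇ a ]· (s ℤ.* x)) y ⟩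
  t ℤ.* ([ b <ᵇ a ]· (s ℤ.* x) ℤ.+ y) ℤ.+ t ℤ.* [ b ≡ᵇ a ]· (s ℤ.* x)
    ≡⟨ cong (λ z → t ℤ.* ([ b <ᵇ a ]· (s ℤ.* x) ℤ.+ y) ℤ.+ z)
        (trans (sym ([]·-* (b ≡ᵇ a) t _)) (cong ([ b ≡ᵇ a ]·_) last)) ⟩
  t ℤ.* ([ b <ᵇ a ]· (s ℤ.* x) ℤ.+ y) ℤ.+ [ b ≡ᵇ a ]· (sgn (suc b) ℤ.* x) ∎
  where
  open ≡-Reasoning
  s = sgn (sum ν)
  t = sgn (suc b + sum ν)
  x = g (suc (suc a) ∷ suc (suc b) ∷ ν)
  y = grow (just (suc b)) (λ κ → g (suc (suc a) ∷ suc b ∷ κ)) ν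
  split : ∀ t u w y → t ℤ.* ((u ℤ.+ w) ℤ.+ y) ≡ t ℤ.* (u ℤ.+ y) ℤ.+ t ℤ.* w
  split = solve-∀
  last : t ℤ.* (s ℤ.* x) ≡ sgn (suc b) ℤ.* x
  last = trans (cong (ℤ._* (s ℤ.* x)) (sgn-+ (suc b) (sum ν)))
    (trans (ℤ.*-assoc (sgn (suc b)) s _) (cong (sgn (suc b) ℤ.*_) (sgn-cancel (sum ν) x)))

-- Two cells added in different rows that do not touch can be added in either order, with
-- opposite signs; only dominoes survive.
grow² : ∀ {N a μ} f → Par (just (suc a)) μ →
  grow N (grow N f) (suc a ∷ μ) ≡
    ([ room N (suc (suc a)) ]· f (suc (suc (suc a)) ∷ μ) ℤ.+ [ room N (suc a) ]· stack f (suc a) μ)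
      ℤ.+ grow (just (suc a)) (grow (just (suc a)) (f ∘ (suc a ∷_))) μ
grow² {N} {a} {μ} f p = begin
  [ R ]· (s ℤ.* ([ R′ ]· (s ℤ.* x) ℤ.+ grow (just (suc (suc a))) g μ))
    ℤ.+ grow (just (suc a)) (λ κ → grow N f (suc a ∷ κ)) μ
    ≡⟨ cong₂ ℤ._+_ upper lower ⟩
  (([ R′ ]· x ℤ.+ [ R ]· stack f (suc a) μ) ℤ.+ [ R ]· (s ℤ.* G)) ℤ.+ (ℤ.- [ R ]· (s ℤ.* G) ℤ.+ G²)
    ≡⟨ cancel ([ R′ ]· x ℤ.+ [ R ]· stack f (suc a) μ) ([ R ]· (s ℤ.* G)) G² ⟩
  ([ R′ ]· x ℤ.+ [ R ]· stack f (suc a) μ) ℤ.+ G² ∎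
  where
  open ≡-Reasoning
  R  = room N (suc a)
  R′ = room N (suc (suc a))
  s  = sgn (sum μ)
  x  = f (suc (suc (suc a)) ∷ μ)
  g  = f ∘ (suc (suc a) ∷_)
  G  = grow (just (suc a)) g μ
  G² = grow (just (suc a)) (grow (just (suc a)) (f ∘ (suc a ∷_))) μ
  cancel : ∀ u v w → (u ℤ.+ v) ℤ.+ (ℤ.- v ℤ.+ w) ≡ u ℤ.+ w
  cancel = solve-∀
  regroup : ∀ u v w → u ℤ.+ (v ℤ.+ w) ≡ (u ℤ.+ w) ℤ.+ v
  regroup = solve-∀

  inner : ∀ R′ → s ℤ.* ([ R′ ]· (s ℤ.* x) ℤ.+ grow (just (suc (suc a))) g μ)
    ≡ ([ R′ ]· x ℤ.+ stack f (suc a) μ) ℤ.+ s ℤ.* G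
  inner R′ = begin
    s ℤ.* ([ R′ ]· (s ℤ.* x) ℤ.+ grow (just (suc (suc a))) g μ)
      ≡⟨ ℤ.*-distribˡ-+ s _ _ ⟩
    s ℤ.* [ R′ ]· (s ℤ.* x) ℤ.+ s ℤ.* grow (just (suc (suc a))) g μ
      ≡⟨ cong₂ ℤ._+_ (trans (sym ([]·-* R′ s _)) (cong ([ R′ ]·_) (sgn-cancel (sum μ) x))) (grow-raise f p) ⟩
    [ R′ ]· x ℤ.+ (s ℤ.* G ℤ.+ stack f (suc a) μ)
      ≡⟨ regroup ([ R′ ]· x) (s ℤ.* G) _ ⟩
    ([ R′ ]· x ℤ.+ stack f (suc a) μ) ℤ.+ s ℤ.* G ∎

  upper : [ R ]· (s ℤ.* ([ R′ ]· (s ℤ.* x) ℤ.+ grow (just (suc (suc a))) g μ))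
    ≡ ([ R′ ]· x ℤ.+ [ R ]· stack f (suc a) μ) ℤ.+ [ R ]· (s ℤ.* G)
  upper with room N (suc a) in eq | room N (suc (suc a)) in eq′ | room-pred N (suc a)
  ... | true  | R′    | _ = inner R′
  ... | false | false | _ = refl
  ... | false | true  | q with () ← q refl

  lower : grow (just (suc a)) (λ κ → grow N f (suc a ∷ κ)) μ ≡ ℤ.- [ R ]· (s ℤ.* G) ℤ.+ G²
  lower = trans (grow-+ (just (suc a)) _ _ μ) (cong (ℤ._+ G²) lift)
    where
    lift : grow (just (suc a)) (λ κ → [ R ]· (sgn (sum κ) ℤ.* g κ)) μ ≡ ℤ.- [ R ]· (s ℤ.* G)
    lift with room N (suc a)
    ... | true  = grow-sgn (just (suc a)) g μ
    ... | false = grow-0 (just (suc a)) μ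

shrink-neg : ∀ f μ → shrink (λ κ → ℤ.- f κ) μ ≡ ℤ.- shrink f μ
shrink-neg f μ = begin
  shrink (λ κ → ℤ.- f κ) μ        ≡⟨ shrink-ext (λ κ → ℤ.-1*i≡-i (f κ)) μ ⟨
  shrink (λ κ → -1ℤ ℤ.* f κ) μ    ≡⟨ shrink-* -1ℤ f μ ⟩
  -1ℤ ℤ.* shrink f μ              ≡⟨ ℤ.-1*i≡-i _ ⟩
  ℤ.- shrink f μ                  ∎
  where open ≡-Reasoning

shrink-0 : ∀ μ → shrink (λ _ → 0ℤ) μ ≡ 0ℤ
shrink-0 μ = trans (shrink-* 0ℤ (λ _ → 0ℤ) μ) (ℤ.*-zeroˡ (shrink (λ _ → 0ℤ) μ))

first-⊙ : ∀ a μ → first (a ⊙ μ) ≡ a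
first-⊙ zero    μ = refl
first-⊙ (suc a) μ = refl

<ᵇ⇒≢ᵇ : ∀ a n → (a <ᵇ n) ≡ true → (a ≡ᵇ n) ≡ false
<ᵇ⇒≢ᵇ zero    (suc n) p = refl
<ᵇ⇒≢ᵇ (suc a) (suc n) p = <ᵇ⇒≢ᵇ a n p

≤ᵇ∧≮ᵇ⇒≡ : ∀ a n → (a <ᵇ suc n) ≡ true → (a <ᵇ n) ≡ false → a ≡ n
≤ᵇ∧≮ᵇ⇒≡ zero    zero    p q = refl
≤ᵇ∧≮ᵇ⇒≡ (suc a) (suc n) p q = cong suc (≤ᵇ∧≮ᵇ⇒≡ a n p q)
≤ᵇ∧≮ᵇ⇒≡ (suc a) zero    () q

≡ᵇ-refl : ∀ n → (n ≡ᵇ n) ≡ true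
≡ᵇ-refl zero    = refl
≡ᵇ-refl (suc n) = ≡ᵇ-refl n

≡ᵇ-sound : ∀ a n → (a ≡ᵇ n) ≡ true → a ≡ n
≡ᵇ-sound zero    zero    _ = refl
≡ᵇ-sound (suc a) (suc n) p = cong suc (≡ᵇ-sound a n p)

suc-≮ᵇ : ∀ n → (suc n <ᵇ n) ≡ false
suc-≮ᵇ zero    = refl
suc-≮ᵇ (suc n) = suc-≮ᵇ n

n≮ᵇn : ∀ n → (n <ᵇ n) ≡ false
n≮ᵇn zero    = refl
n≮ᵇn (suc n) = n≮ᵇn n

-- Removing a cell never lengthens the first row, so the guard stays true in every term.
shrink-restrict : ∀ {n μ} g → (first μ <ᵇ n) ≡ true →
  shrink (λ κ → [ first κ <ᵇ n ]· g κ) μ ≡ shrink g μ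
shrink-restrict {n} {[]} g t = refl
shrink-restrict {n} {a ∷ μ} g t = cong₂ ℤ._-_ head
  (shrink-ext (λ κ → cong (λ b → [ b ]· g (a ∷ κ)) t) μ)
  where
  <ᵇ-predˡ : ∀ a → (a <ᵇ n) ≡ true → (pred a <ᵇ n) ≡ true
  <ᵇ-predˡ zero    p = p
  <ᵇ-predˡ (suc a) p = room-pred (just n) a p
  head : [ first μ <ᵇ a ]· (sgn (sum μ) ℤ.* [ first (pred a ⊙ μ) <ᵇ n ]· g (pred a ⊙ μ))
       ≡ [ first μ <ᵇ a ]· (sgn (sum μ) ℤ.* g (pred a ⊙ μ))
  head rewrite first-⊙ (pred a) μ | <ᵇ-predˡ a t = refl

-- Mirror image of `grow²`. If the first row is longer than the second, removing its end commutes
-- with any removal below up to a sign, and the mixed terms cancel. If the two rows are equally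
-- long, one order alone is possible, and it removes a vertical domino.
shrink² : ∀ {a μ} f → Par (just (suc a)) μ →
  shrink (shrink f) (suc a ∷ μ) ≡
    ([ first μ <ᵇ a ]· f (pred a ⊙ μ) ℤ.+ unstack f a μ) ℤ.+ shrink (shrink (f ∘ (suc a ∷_))) μ
shrink² {a} {μ} f p = begin
  U ℤ.- shrink (λ κ → restr κ ℤ.- shrink (f ∘ (suc a ∷_)) κ) μ
    ≡⟨ cong (λ z → U ℤ.- z) (trans (shrink-+ restr _ μ) (cong (λ z → shrink restr μ ℤ.+ z) (shrink-neg _ μ))) ⟩
  U ℤ.- (shrink restr μ ℤ.- S²)
    ≡⟨ regroup U (shrink restr μ) S² ⟩
  (U ℤ.- shrink restr μ) ℤ.+ S²
    ≡⟨ cong (ℤ._+ S²) (dominoes a p) ⟩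
  ([ first μ <ᵇ a ]· f (pred a ⊙ μ) ℤ.+ unstack f a μ) ℤ.+ S² ∎
  where
  open ≡-Reasoning
  restr = λ κ → [ first κ <ᵇ suc a ]· (sgn (sum κ) ℤ.* f (a ⊙ κ))
  U = [ first μ <ᵇ suc a ]· (sgn (sum μ) ℤ.* shrink f (a ⊙ μ))
  S² = shrink (shrink (f ∘ (suc a ∷_))) μ
  regroup : ∀ u v w → u ℤ.- (v ℤ.- w) ≡ (u ℤ.- v) ℤ.+ w
  regroup = solve-∀
  unit : ∀ x → 1ℤ ℤ.* (1ℤ ℤ.* x ℤ.- 0ℤ) ℤ.- 0ℤ ≡ x ℤ.+ 0ℤ
  unit = solve-∀
  cancel : ∀ s u v → s ℤ.* (u ℤ.- v) ℤ.- (ℤ.- (s ℤ.* v)) ≡ s ℤ.* u ℤ.+ 0ℤ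
  cancel = solve-∀

  dominoes : ∀ a {κ} → Par (just (suc a)) κ →
    [ first κ <ᵇ suc a ]· (sgn (sum κ) ℤ.* shrink f (a ⊙ κ))
      ℤ.- shrink (λ κ → [ first κ <ᵇ suc a ]· (sgn (sum κ) ℤ.* f (a ⊙ κ))) κ
    ≡ [ first κ <ᵇ a ]· f (pred a ⊙ κ) ℤ.+ unstack f a κ
  dominoes zero    [] = refl
  dominoes (suc a) [] = unit (f (a ⊙ []))
  dominoes a {suc b ∷ ν} (r ∷ q) = compare a r q (b <ᵇ a) refl
    where
    compare : ∀ a {b ν} → (b <ᵇ suc a) ≡ true → Par (just (suc b)) ν → ∀ c → (b <ᵇ a) ≡ c →
      [ b <ᵇ a ]· (sgn (suc b + sum ν) ℤ.* shrink f (a ⊙ (suc b ∷ ν)))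
        ℤ.- shrink (λ κ → [ first κ <ᵇ suc a ]· (sgn (sum κ) ℤ.* f (a ⊙ κ))) (suc b ∷ ν)
      ≡ [ suc b <ᵇ a ]· f (pred a ⊙ (suc b ∷ ν)) ℤ.+ unstack f a (suc b ∷ ν)
    compare (suc a) {b} {ν} r q true eq = begin
      [ b <ᵇ suc a ]· (s ℤ.* ([ b <ᵇ a ]· (s ℤ.* x) ℤ.- V)) ℤ.- W
        ≡⟨ cong₂ (λ e z → [ e ]· (s ℤ.* ([ b <ᵇ a ]· (s ℤ.* x) ℤ.- V)) ℤ.- z) eq
            (trans (shrink-restrict {suc (suc a)} {κ} (λ κ → sgn (sum κ) ℤ.* f (suc a ∷ κ)) eq)
              (shrink-sgn {just (suc (suc a))} (f ∘ (suc a ∷_)) (r ∷ q))) ⟩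
      s ℤ.* ([ b <ᵇ a ]· (s ℤ.* x) ℤ.- V) ℤ.- (ℤ.- (s ℤ.* V))
        ≡⟨ cancel s ([ b <ᵇ a ]· (s ℤ.* x)) V ⟩
      s ℤ.* [ b <ᵇ a ]· (s ℤ.* x) ℤ.+ 0ℤ
        ≡⟨ cong (ℤ._+ 0ℤ) (trans (sym ([]·-* (b <ᵇ a) s _)) (cong ([ b <ᵇ a ]·_) (sgn-cancel (sum κ) x))) ⟩
      [ b <ᵇ a ]· x ℤ.+ 0ℤ
        ≡⟨ cong (λ e → [ b <ᵇ a ]· x ℤ.+ [ e ∧ (first ν <ᵇ suc b) ]· (sgn (suc b) ℤ.* f (suc a ∷ (b ⊙ ν)))) (<ᵇ⇒≢ᵇ b (suc a) eq) ⟨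
      [ b <ᵇ a ]· x ℤ.+ unstack f (suc a) κ ∎
      where
      κ = suc b ∷ ν
      s = sgn (sum κ)
      x = f (a ⊙ κ)
      V = shrink (f ∘ (suc a ∷_)) κ
      W = shrink (λ κ → [ first κ <ᵇ suc (suc a) ]· (sgn (sum κ) ℤ.* f (suc a ∷ κ))) κ
    -- The first two rows are equally long. A removal inside `ν` leaves them so and keeps the guard
    -- false, hence `shrink-0`; only the end of the second row frees the end of the first.
    compare a {b} {ν} r q false eq with refl ← ≤ᵇ∧≮ᵇ⇒≡ b a r eq
      rewrite suc-≮ᵇ a | n≮ᵇn a | ≡ᵇ-refl a | first-⊙ a ν | <ᵇ-suc a | shrink-0 ν
      with first ν <ᵇ suc a in t
    ... | false = refl
    ... | true  = begin
      0ℤ ℤ.- (s ℤ.* (sgn (sum (a ⊙ ν)) ℤ.* x) ℤ.- 0ℤ)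
        ≡⟨ cong (λ z → 0ℤ ℤ.- (s ℤ.* (z ℤ.* x) ℤ.- 0ℤ)) (trans (cong sgn (⊙-size q t)) (sgn-+ a (sum ν))) ⟩
      0ℤ ℤ.- (s ℤ.* (sgn a ℤ.* s ℤ.* x) ℤ.- 0ℤ)
        ≡⟨ swap s (sgn a) x ⟩
      0ℤ ℤ.+ ℤ.- sgn a ℤ.* (s ℤ.* (s ℤ.* x))
        ≡⟨ cong₂ (λ y z → 0ℤ ℤ.+ y ℤ.* z) (sym (sgn-suc a)) (sgn-cancel (sum ν) x) ⟩
      0ℤ ℤ.+ sgn (suc a) ℤ.* x ∎
      where
      s = sgn (sum ν)
      x = f (a ⊙ (a ⊙ ν))
      swap : ∀ s t x → 0ℤ ℤ.- (s ℤ.* (t ℤ.* s ℤ.* x) ℤ.- 0ℤ) ≡ 0ℤ ℤ.+ ℤ.- t ℤ.* (s ℤ.* (s ℤ.* x))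
      swap = solve-∀

-- Monomial weights and the domino relation

Weight : Set
Weight = ℕ → ℕ → ℕ → ℤ

-- The flag says whether the first part counts as an even row.
evenCells : Bool → List ℕ → ℕ
evenCells b     []      = 0
evenCells false (a ∷ μ) = evenCells true μ
evenCells true  (a ∷ μ) = a + evenCells false μ

evenHalves : Bool → List ℕ → ℕ
evenHalves b     []      = 0
evenHalves false (a ∷ μ) = evenHalves true μ
evenHalves true  (a ∷ μ) = ⌊ a /2⌋ + evenHalves false μ

-- The arguments of `h` are the exponents of x, of y, and the common exponent of q and t.
weigh : Bool → Weight → List ℕ → ℤ
weigh b h μ = h (v μ) (evenCells b μ) (evenHalves b μ)

shift : ℕ → ℕ → ℕ → Weight → Weight
shift i j k h p q r = h (i + p) (j + q) (k + r)

-- A first row only shifts the exponents, so it can be absorbed into the weight. This closes the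
-- induction over rows and is why a weight is an arbitrary function.
addRow : Bool → ℕ → Weight → Weight
addRow false a = shift ⌊ a /2⌋ 0 0
addRow true  a = shift ⌊ a /2⌋ a ⌊ a /2⌋

weigh-∷ : ∀ b h a μ → weigh b h (a ∷ μ) ≡ weigh (not b) (addRow b a h) μ
weigh-∷ false h a μ = refl
weigh-∷ true  h a μ = refl

cong₃ : ∀ (h : Weight) {p p′ q q′ r r′} → p ≡ p′ → q ≡ q′ → r ≡ r′ → h p q r ≡ h p′ q′ r′
cong₃ h refl refl refl = refl

weigh-shift-∷ : ∀ b i j k h a μ → weigh b (shift i j k h) (a ∷ μ) ≡ weigh (not b) (shift i j k (addRow b a h)) μ
weigh-shift-∷ false i j k h a μ = cong₃ h (x∙yz≈y∙xz i ⌊ a /2⌋ (v μ)) refl refl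
weigh-shift-∷ true  i j k h a μ = cong₃ h
  (x∙yz≈y∙xz i ⌊ a /2⌋ (v μ))
  (x∙yz≈y∙xz j a (evenCells false μ))
  (x∙yz≈y∙xz k ⌊ a /2⌋ (evenHalves false μ))

-- hor and ver multiply by the monomial of a horizontal domino and (up to sign) of a vertical
-- domino in column n + 1.
hor : Bool → Weight → Weight
hor false = shift 1 0 0
hor true  = shift 1 2 1

weigh-hor-∷ : ∀ b h a μ → weigh b (hor (not b) h) (a ∷ μ) ≡ weigh (not b) (hor (not b) (addRow b a h)) μ
weigh-hor-∷ false = weigh-shift-∷ false 1 2 1
weigh-hor-∷ true  = weigh-shift-∷ true 1 0 0

parity : ℕ → ℕ
parity zero          = 0
parity (suc zero)    = 1
parity (suc (suc n)) = parity n

ver : ℕ → Weight → Weight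
ver n = shift (parity n + parity n) 1 (parity n)

⌊suc/2⌋ : ∀ n → ⌊ suc n /2⌋ ≡ parity n + ⌊ n /2⌋
⌊suc/2⌋ zero          = refl
⌊suc/2⌋ (suc zero)    = refl
⌊suc/2⌋ (suc (suc n)) = trans (cong suc (⌊suc/2⌋ n)) (sym (ℕ.+-suc (parity n) ⌊ n /2⌋))

parity-suc : ∀ n → (parity n ≡ 0 × parity (suc n) ≡ 1) ⊎ (parity n ≡ 1 × parity (suc n) ≡ 0)
parity-suc zero          = inj₁ (refl , refl)
parity-suc (suc zero)    = inj₂ (refl , refl)
parity-suc (suc (suc n)) = parity-suc n

weigh-add-hor : ∀ b h a μ → weigh b h (suc (suc a) ∷ μ) ≡ weigh b (hor b h) (a ∷ μ)
weigh-add-hor false h a μ = refl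
weigh-add-hor true  h a μ = refl

-- Each halved row grows by `parity a`, and exactly one of the two rows is even, whatever `b` is.
weigh-add-ver : ∀ b h a μ → weigh b h (suc a ∷ suc a ∷ μ) ≡ weigh b (ver a h) (a ∷ a ∷ μ)
weigh-add-ver b h a μ = go b
  where
  c = parity a
  v-step : ∀ n c k m → n ≡ c + k → n + (n + m) ≡ (c + c) + (k + (k + m))
  v-step _ c k m refl = lemma c k m
    where
    lemma : ∀ c k m → (c + k) + ((c + k) + m) ≡ (c + c) + (k + (k + m))
    lemma = ℕ-Solver.solve-∀
  halves-step : ∀ n c k m → n ≡ c + k → n + m ≡ c + (k + m)
  halves-step _ c k m refl = ℕ.+-assoc c k m
  go : ∀ b → weigh b h (suc a ∷ suc a ∷ μ) ≡ weigh b (ver a h) (a ∷ a ∷ μ)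
  go false = cong₃ h (v-step _ c ⌊ a /2⌋ (v μ) (⌊suc/2⌋ a)) refl (halves-step _ c ⌊ a /2⌋ _ (⌊suc/2⌋ a))
  go true  = cong₃ h (v-step _ c ⌊ a /2⌋ (v μ) (⌊suc/2⌋ a)) refl (halves-step _ c ⌊ a /2⌋ _ (⌊suc/2⌋ a))

weigh-remove-hor : ∀ b h {a μ} → Par (just (suc (suc a))) μ → (first μ <ᵇ suc a) ≡ true →
  weigh b (shift 2 2 1 h) (a ⊙ μ) ≡ weigh b (hor (not b) h) (suc (suc a) ∷ μ)
weigh-remove-hor false h {suc a} _  _ = refl
weigh-remove-hor true  h {suc a} _  _ = refl
weigh-remove-hor false h {zero}  [] _ = refl
weigh-remove-hor true  h {zero}  [] _ = refl
weigh-remove-hor b     h {zero}  (_ ∷ _) ()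

-- Adjacent columns have opposite parity, so just one of the two dominoes contributes x² q t, and
-- each contributes y.
weigh-remove-ver : ∀ b h {a μ} → Par (just (suc a)) μ → (first μ <ᵇ suc a) ≡ true →
  weigh b (shift 2 2 1 h) (a ⊙ (a ⊙ μ)) ≡ weigh b (ver (suc a) h) (suc a ∷ suc a ∷ μ)
weigh-remove-ver false h {zero} [] _ = refl
weigh-remove-ver true  h {zero} [] _ = refl
weigh-remove-ver b h {zero} (_ ∷ _) ()
weigh-remove-ver b h {suc a} {μ} _ _ = trans both (sym (weigh-add-ver b (ver (suc (suc a)) h) (suc a) μ))
  where
  κ = suc a ∷ suc a ∷ μ
  both : weigh b (shift 2 2 1 h) κ ≡ weigh b (ver (suc a) (ver (suc (suc a)) h)) κ
  both with parity a | parity (suc a) | parity-suc a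
  ... | _ | _ | inj₁ (refl , refl) = refl
  ... | _ | _ | inj₂ (refl , refl) = refl

full : ℕ → List ℕ → Bool
full n (a ∷ b ∷ _) = (a ≡ᵇ n) ∧ (b ≡ᵇ n)
full n _           = false

-- A vertical domino removable from column n would be matched with one addable to column n + 1,
-- which the bound n forbids.
excess : Bool → Bound → Weight → List ℕ → ℤ
excess b nothing  h μ = 0ℤ
excess b (just n) h μ = [ full n μ ]· (sgn n ℤ.* weigh b (ver n h) μ)

-- All four terms vanish unless the first two rows are equally long. In that case exactly one term
-- survives on each side, with the same value: on the left according to whether the bound leaves
-- room to lengthen them, on the right according to whether the third row is as long or shorter.
vertical : ∀ b {N} h a {μ} → room N a ≡ true → Par (just (suc a)) μ →
  [ room N (suc a) ]· stack (weigh b h) (suc a) μ ℤ.+ excess b N h (suc a ∷ μ)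
    ≡ [ full (suc a) μ ]· (sgn (suc a) ℤ.* weigh b (ver (suc a) h) (suc a ∷ μ))
        ℤ.+ unstack (weigh b (shift 2 2 1 h)) a μ
vertical b {nothing} h a r [] = refl
vertical b {just n}  h a r [] = cong (ℤ._+ 0ℤ) ([]·-0 (suc a <ᵇ n))
vertical b {N} h a r (_∷_ {c} {ν} s p) = compare (c ≡ᵇ a) refl
  where
  W = sgn (suc a) ℤ.* weigh b (ver (suc a) h) (suc a ∷ suc a ∷ ν)

  excess-≢ : ∀ N → (c ≡ᵇ a) ≡ false → excess b N h (suc a ∷ suc c ∷ ν) ≡ 0ℤ
  excess-≢ nothing  _ = refl
  excess-≢ (just n) q with suc a ≡ᵇ n in e₁ | suc c ≡ᵇ n in e₂
  ... | false | _     = refl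
  ... | true  | false = refl
  ... | true  | true  with refl ← ≡ᵇ-sound (suc a) n e₁ with () ← trans (sym q) e₂

  added : ∀ N → room N a ≡ true →
    [ room N (suc a) ]· (sgn (suc a) ℤ.* weigh b h (suc (suc a) ∷ suc (suc a) ∷ ν))
      ℤ.+ excess b N h (suc a ∷ suc a ∷ ν) ≡ W
  added nothing  _ = trans (ℤ.+-identityʳ _) (cong (sgn (suc a) ℤ.*_) (weigh-add-ver b h (suc a) ν))
  added (just (suc n)) r with a ≡ᵇ n in e
  ... | false = trans (ℤ.+-identityʳ _) (trans (cong (λ z → [ z ]· (sgn (suc a) ℤ.* weigh b h (suc (suc a) ∷ suc (suc a) ∷ ν))) lt)
                  (cong (sgn (suc a) ℤ.*_) (weigh-add-ver b h (suc a) ν)))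
    where
    lt : (a <ᵇ n) ≡ true
    lt with a <ᵇ n in e′
    ... | true = refl
    ... | false with refl ← ≤ᵇ∧≮ᵇ⇒≡ a n r e′ = trans (sym e) (≡ᵇ-refl a)
  ... | true with refl ← ≡ᵇ-sound a n e rewrite n≮ᵇn a = ℤ.+-identityˡ _

  removed : ∀ {ν} → Par (just (suc a)) ν → let w = sgn (suc a) ℤ.* weigh b (ver (suc a) h) (suc a ∷ suc a ∷ ν) in
    [ full (suc a) (suc a ∷ ν) ]· w
      ℤ.+ [ first ν <ᵇ suc a ]· (sgn (suc a) ℤ.* weigh b (shift 2 2 1 h) (a ⊙ (a ⊙ ν))) ≡ w
  removed [] = trans (ℤ.+-identityˡ _) (cong (sgn (suc a) ℤ.*_) (weigh-remove-ver b h {a} [] refl))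
  removed {ν} q@(_∷_ {c} r _) rewrite ≡ᵇ-refl a with c <ᵇ a in e
  ... | true rewrite <ᵇ⇒≢ᵇ c a e = trans (ℤ.+-identityˡ _) (cong (sgn (suc a) ℤ.*_) (weigh-remove-ver b h q e))
  ... | false with refl ← ≤ᵇ∧≮ᵇ⇒≡ c a r e rewrite ≡ᵇ-refl a = ℤ.+-identityʳ _

  compare : ∀ e → (c ≡ᵇ a) ≡ e →
    [ room N (suc a) ]· ([ c ≡ᵇ a ]· (sgn (suc c) ℤ.* weigh b h (suc (suc a) ∷ suc (suc c) ∷ ν)))
        ℤ.+ excess b N h (suc a ∷ suc c ∷ ν)
      ≡ [ full (suc a) (suc c ∷ ν) ]· (sgn (suc a) ℤ.* weigh b (ver (suc a) h) (suc a ∷ suc c ∷ ν))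
        ℤ.+ [ (c ≡ᵇ a) ∧ (first ν <ᵇ suc c) ]· (sgn (suc c) ℤ.* weigh b (shift 2 2 1 h) (a ⊙ (c ⊙ ν)))
  compare true e with refl ← ≡ᵇ-sound c a e = begin
    [ room N (suc a) ]· ([ a ≡ᵇ a ]· X) ℤ.+ excess b N h (suc a ∷ suc a ∷ ν)
      ≡⟨ cong (λ z → [ room N (suc a) ]· ([ z ]· X) ℤ.+ excess b N h (suc a ∷ suc a ∷ ν)) e ⟩
    [ room N (suc a) ]· X ℤ.+ excess b N h (suc a ∷ suc a ∷ ν)
      ≡⟨ added N r ⟩
    W
      ≡⟨ removed p ⟨
    [ full (suc a) (suc a ∷ ν) ]· W ℤ.+ [ first ν <ᵇ suc a ]· Y
      ≡⟨ cong (λ z → [ full (suc a) (suc a ∷ ν) ]· W ℤ.+ [ z ∧ (first ν <ᵇ suc a) ]· Y) e ⟨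
    [ full (suc a) (suc a ∷ ν) ]· W ℤ.+ [ (a ≡ᵇ a) ∧ (first ν <ᵇ suc a) ]· Y ∎
    where
    open ≡-Reasoning
    X = sgn (suc a) ℤ.* weigh b h (suc (suc a) ∷ suc (suc a) ∷ ν)
    Y = sgn (suc a) ℤ.* weigh b (shift 2 2 1 h) (a ⊙ (a ⊙ ν))
  compare false e rewrite e = trans (cong₂ ℤ._+_ ([]·-0 (room N (suc a))) (excess-≢ N e))
    (sym (cong (λ z → [ z ]· (sgn (suc a) ℤ.* weigh b (ver (suc a) h) (suc a ∷ suc c ∷ ν)) ℤ.+ 0ℤ) (not-full ν)))
    where
    not-full : ∀ ν → full (suc a) (suc c ∷ ν) ≡ false
    not-full []      = refl
    not-full (_ ∷ _) rewrite e = refl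

-- The tail satisfies the relation with the row parity flipped and the first row as its bound. Its
-- horizontal term turns into the horizontal domino removed from the first row, its first-column
-- term is that of the whole partition, and `vertical` trades its excess for the vertical dominoes
-- in the first two rows.
domino-relation : ∀ b {N μ} h → room N 0 ≡ true → Par N μ →
  grow N (grow N (weigh b h)) μ ℤ.+ excess b N h μ ≡
    ([ room N (suc (first μ)) ]· weigh b (hor b h) μ ℤ.+ weigh b (shift 0 1 0 h) μ)
      ℤ.+ shrink (shrink (weigh b (shift 2 2 1 h))) μ
domino-relation b {N} h r [] = begin
  [ room N 0 ]· ([ room N 1 ]· (1ℤ ℤ.* weigh b h (2 ∷ [])) ℤ.+ weigh b h (1 ∷ 1 ∷ [])) ℤ.+ excess b N h []
    ≡⟨ cong₂ (λ e z → [ e ]· ([ room N 1 ]· (1ℤ ℤ.* weigh b h (2 ∷ [])) ℤ.+ weigh b h (1 ∷ 1 ∷ [])) ℤ.+ z) r (excess-[] N) ⟩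
  ([ room N 1 ]· (1ℤ ℤ.* weigh b h (2 ∷ [])) ℤ.+ weigh b h (1 ∷ 1 ∷ [])) ℤ.+ 0ℤ
    ≡⟨ cong (ℤ._+ 0ℤ) (cong₂ ℤ._+_ (cong ([ room N 1 ]·_) (trans (ℤ.*-identityˡ _) (twoCells b))) (twoRows b)) ⟩
  ([ room N 1 ]· weigh b (hor b h) [] ℤ.+ weigh b (shift 0 1 0 h) []) ℤ.+ 0ℤ ∎
  where
  open ≡-Reasoning
  excess-[] : ∀ N → excess b N h [] ≡ 0ℤ
  excess-[] nothing  = refl
  excess-[] (just _) = refl
  twoCells : ∀ b → weigh b h (2 ∷ []) ≡ weigh b (hor b h) []
  twoCells false = refl
  twoCells true  = refl
  twoRows : ∀ b → weigh b h (1 ∷ 1 ∷ []) ≡ weigh b (shift 0 1 0 h) []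
  twoRows false = refl
  twoRows true  = refl
domino-relation b {N} {suc a ∷ μ} h _ (r ∷ p) = begin
  grow N (grow N (weigh b h)) (suc a ∷ μ) ℤ.+ excess b N h (suc a ∷ μ)
    ≡⟨ cong (ℤ._+ excess b N h (suc a ∷ μ)) (trans (grow² {N} (weigh b h) p) (cong₂ (λ y z → ([ room N (suc (suc a)) ]· y ℤ.+ S) ℤ.+ z)
         (weigh-add-hor b h (suc a) μ)
         (grow-ext _ (grow-ext _ (weigh-∷ b h (suc a))) μ))) ⟩
  ((H ℤ.+ S) ℤ.+ G) ℤ.+ excess b N h (suc a ∷ μ)
    ≡⟨ regroup₁ H S G _ ⟩
  H ℤ.+ (S ℤ.+ excess b N h (suc a ∷ μ)) ℤ.+ G
    ≡⟨ cong (λ z → H ℤ.+ z ℤ.+ G) (vertical b {N} h a r p) ⟩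
  H ℤ.+ (E ℤ.+ U) ℤ.+ G
    ≡⟨ regroup₂ H E U G ⟩
  H ℤ.+ U ℤ.+ (G ℤ.+ E)
    ≡⟨ cong (λ z → H ℤ.+ U ℤ.+ z) (trans (cong (λ z → G ℤ.+ [ full (suc a) μ ]· (sgn (suc a) ℤ.* z))
         (weigh-shift-∷ b _ _ _ h (suc a) μ)) (domino-relation (not b) (addRow b (suc a) h) refl p)) ⟩
  H ℤ.+ U ℤ.+ (([ first μ <ᵇ a ]· weigh (not b) (hor (not b) (addRow b (suc a) h)) μ ℤ.+ weigh (not b) (shift 0 1 0 (addRow b (suc a) h)) μ)
    ℤ.+ shrink (shrink (weigh (not b) (shift 2 2 1 (addRow b (suc a) h)))) μ)
    ≡⟨ cong₂ (λ y z → H ℤ.+ U ℤ.+ (y ℤ.+ z))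
        (cong₂ ℤ._+_ (removable a p) (sym (weigh-shift-∷ b 0 1 0 h (suc a) μ)))
        (sym (shrink-ext (shrink-ext (weigh-shift-∷ b 2 2 1 h (suc a))) μ)) ⟩
  H ℤ.+ U ℤ.+ ((R ℤ.+ Y) ℤ.+ S²)
    ≡⟨ regroup₃ H U R Y S² ⟩
  (H ℤ.+ Y) ℤ.+ ((R ℤ.+ U) ℤ.+ S²)
    ≡⟨ cong (λ z → (H ℤ.+ Y) ℤ.+ z) (shrink² (weigh b (shift 2 2 1 h)) p) ⟨
  (H ℤ.+ Y) ℤ.+ shrink (shrink (weigh b (shift 2 2 1 h))) (suc a ∷ μ) ∎
  where
  open ≡-Reasoning
  H = [ room N (suc (suc a)) ]· weigh b (hor b h) (suc a ∷ μ)
  S = [ room N (suc a) ]· stack (weigh b h) (suc a) μ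
  G = grow (just (suc a)) (grow (just (suc a)) (weigh (not b) (addRow b (suc a) h))) μ
  E = [ full (suc a) μ ]· (sgn (suc a) ℤ.* weigh b (ver (suc a) h) (suc a ∷ μ))
  U = unstack (weigh b (shift 2 2 1 h)) a μ
  R = [ first μ <ᵇ a ]· weigh b (shift 2 2 1 h) (pred a ⊙ μ)
  Y = weigh b (shift 0 1 0 h) (suc a ∷ μ)
  S² = shrink (shrink (λ κ → weigh b (shift 2 2 1 h) (suc a ∷ κ))) μ
  regroup₁ : ∀ h s g x → ((h ℤ.+ s) ℤ.+ g) ℤ.+ x ≡ h ℤ.+ (s ℤ.+ x) ℤ.+ g
  regroup₁ = solve-∀
  regroup₂ : ∀ h e u g → h ℤ.+ (e ℤ.+ u) ℤ.+ g ≡ h ℤ.+ u ℤ.+ (g ℤ.+ e)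
  regroup₂ = solve-∀
  regroup₃ : ∀ h u r y s → h ℤ.+ u ℤ.+ ((r ℤ.+ y) ℤ.+ s) ≡ (h ℤ.+ y) ℤ.+ ((r ℤ.+ u) ℤ.+ s)
  regroup₃ = solve-∀

  removable : ∀ a {μ} → Par (just (suc a)) μ →
    [ first μ <ᵇ a ]· weigh (not b) (hor (not b) (addRow b (suc a) h)) μ ≡ [ first μ <ᵇ a ]· weigh b (shift 2 2 1 h) (pred a ⊙ μ)
  removable zero    p = refl
  removable (suc a) {μ} p with first μ <ᵇ suc a in t
  ... | false = refl
  ... | true  = sym (trans (weigh-remove-hor b h p t) (weigh-hor-∷ b h (suc (suc a)) μ))

∂^-weigh : ∀ m h → ∂^ (suc (suc m)) (weigh false h) [] ≡ ∂^ m (weigh false (shift 1 0 0 h)) [] ℤ.+ ∂^ m (weigh false (shift 0 1 0 h)) []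
∂^-weigh m h = begin
  ∂^ m (∂ (∂ (weigh false h))) []
    ≡⟨ ∂^-cong m (λ p → trans (sym (ℤ.+-identityʳ _)) (domino-relation false h refl p)) ⟩
  ∂^ m (λ κ → X κ ℤ.+ Y κ ℤ.+ Z κ) []
    ≡⟨ ∂^-+ m (λ κ → X κ ℤ.+ Y κ) Z ⟩
  ∂^ m (λ κ → X κ ℤ.+ Y κ) [] ℤ.+ ∂^ m Z []
    ≡⟨ cong₂ ℤ._+_ (∂^-+ m X Y) (∂^-shrink² m (weigh false (shift 2 2 1 h))) ⟩
  ∂^ m X [] ℤ.+ ∂^ m Y [] ℤ.+ 0ℤ
    ≡⟨ ℤ.+-identityʳ _ ⟩
  ∂^ m X [] ℤ.+ ∂^ m Y [] ∎
  where
  open ≡-Reasoning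
  X = weigh false (shift 1 0 0 h)
  Y = weigh false (shift 0 1 0 h)
  Z = shrink (shrink (weigh false (shift 2 2 1 h)))

-- Building standard tableaux by inserting the largest entry

-- Besides the column condition this says that `r` is no longer than `p`, so partition shape needs
-- no separate condition.
data Over : List ℕ → List ℕ → Set where
  []  : ∀ {p} → Over p []
  _∷_ : ∀ {a b p r} → a < b → Over p r → Over (a ∷ p) (b ∷ r)

data Under : Maybe (List ℕ) → List ℕ → Set where
  top   : ∀ {r} → Under nothing r
  under : ∀ {p r} → Over p r → Under (just p) r

data Std (prev : Maybe (List ℕ)) : Tableau → Set where
  []  : Std prev []
  cons : ∀ {a r T} → Under prev (a ∷ r) → Linked _<_ (a ∷ r) → Std (just (a ∷ r)) T → Std prev ((a ∷ r) ∷ T)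

data Insert (N : Bound) (k : ℕ) : Tableau → Tableau → Set where
  new   : room N 0 ≡ true → Insert N k [] ((k ∷ []) ∷ [])
  here  : ∀ {r T} → room N (length r) ≡ true → Insert N k (r ∷ T) ((r ∷ʳ k) ∷ T)
  there : ∀ {r T T′} → Insert (just (length r)) k T T′ → Insert N k (r ∷ T) (r ∷ T′)

infix 8 _if_
_if_ : ∀ {A : Set} → A → Bool → List A
x if true  = x ∷ []
x if false = []

∈-if⁺ : ∀ {A : Set} {x : A} {b} → b ≡ true → x ∈ x if b
∈-if⁺ refl = here refl

∈-if⁻ : ∀ {A : Set} {x y : A} b → y ∈ x if b → y ≡ x × b ≡ true
∈-if⁻ true (here p) = p , refl

insertions : Bound → ℕ → Tableau → List Tableau
insertions N k []      = ((k ∷ []) ∷ []) if room N 0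
insertions N k (r ∷ T) = ((r ∷ʳ k) ∷ T) if room N (length r) ++ map (r ∷_) (insertions (just (length r)) k T)

∈-insertions⁺ : ∀ {N k T T′} → Insert N k T T′ → T′ ∈ insertions N k T
∈-insertions⁺ (new r)   = ∈-if⁺ r
∈-insertions⁺ (here r)  = ∈-++⁺ˡ (∈-if⁺ r)
∈-insertions⁺ {N} {k} (there {r} {T} i) = ∈-++⁺ʳ ((r ∷ʳ k ∷ T) if room N (length r)) (∈-map⁺ (r ∷_) (∈-insertions⁺ i))

∈-insertions⁻ : ∀ {N k} T {T′} → T′ ∈ insertions N k T → Insert N k T T′
∈-insertions⁻ {N} [] m with refl , r ← ∈-if⁻ (room N 0) m = new r
∈-insertions⁻ {N} {k} (r ∷ T) m with ∈-++⁻ (((r ∷ʳ k) ∷ T) if room N (length r)) m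
... | inj₁ m₁ with refl , q ← ∈-if⁻ (room N (length r)) m₁ = here q
... | inj₂ m₂ with _ , m₃ , refl ← ∈-map⁻ (r ∷_) m₂ = there (∈-insertions⁻ T m₃)

Over-∷ʳ⁺ : ∀ {k p r} → Over p r → (length r <ᵇ length p) ≡ true → All (_< k) p → Over p (r ∷ʳ k)
Over-∷ʳ⁺ {p = _ ∷ _} [] _ (a<k ∷ _) = a<k ∷ []
Over-∷ʳ⁺ (a<b ∷ o)     l (_ ∷ p<k)  = a<b ∷ Over-∷ʳ⁺ o l p<k

Over-∷ʳ⁻ : ∀ {k p} r → Over p (r ∷ʳ k) → Over p r × (length r <ᵇ length p) ≡ true
Over-∷ʳ⁻ []      (_ ∷ _) = [] , refl
Over-∷ʳ⁻ (_ ∷ r) (a<b ∷ o) with o′ , l ← Over-∷ʳ⁻ r o = a<b ∷ o′ , l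

Over-++ : ∀ {p r} q → Over p r → Over (p ++ q) r
Over-++ q []        = []
Over-++ q (a<b ∷ o) = a<b ∷ Over-++ q o

-- An entry beneath `k` would exceed `k`, so `r` does not reach that column.
Over-init : ∀ {k r} p → Over (p ∷ʳ k) r → All (_≤ k) r → Over p r
Over-init []      []        _ = []
Over-init []      (k<b ∷ _) (b≤k ∷ _) = contradiction k<b (ℕ.≤⇒≯ b≤k)
Over-init (_ ∷ p) []        _ = []
Over-init (_ ∷ p) (a<b ∷ o) (_ ∷ r≤k) = a<b ∷ Over-init p o r≤k

Linked-∷ʳ⁺ : ∀ {k r} → Linked _<_ r → All (_< k) r → Linked _<_ (r ∷ʳ k)
Linked-∷ʳ⁺ []      _             = [-]
Linked-∷ʳ⁺ [-]     (a<k ∷ [])    = a<k ∷ [-]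
Linked-∷ʳ⁺ (a<b ∷ l) (_ ∷ r<k) = a<b ∷ Linked-∷ʳ⁺ l r<k

Linked-∷ʳ⁻ : ∀ {k : ℕ} r → Linked _<_ (r ∷ʳ k) → Linked _<_ r
Linked-∷ʳ⁻ []          _         = []
Linked-∷ʳ⁻ (_ ∷ [])    _         = [-]
Linked-∷ʳ⁻ (_ ∷ _ ∷ r) (a<b ∷ l) = a<b ∷ Linked-∷ʳ⁻ (_ ∷ r) l

maximum-last : ∀ {k r} → Linked _<_ r → All (_≤ k) r → k ∈ r → ∃[ r₀ ] r ≡ r₀ ∷ʳ k
maximum-last {r = a ∷ []}    _         _            (here refl) = [] , refl
maximum-last {r = a ∷ b ∷ r} (a<b ∷ l) (_ ∷ b≤k ∷ _) (here refl) = contradiction a<b (ℕ.≤⇒≯ b≤k)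
maximum-last {r = a ∷ b ∷ r} (a<b ∷ l) (_ ∷ r≤k) (there k∈) with r₀ , eq ← maximum-last l r≤k k∈ = a ∷ r₀ , cong (a ∷_) eq

Insert-↭ : ∀ {N k T T′} → Insert N k T T′ → concat T′ ↭ k ∷ concat T
Insert-↭ (new _) = ↭-refl
Insert-↭ {k = k} (here {r} {T} _) = ↭-trans (↭-reflexive (++-assoc r (k ∷ []) (concat T))) (↭.shift k r (concat T))
Insert-↭ {k = k} (there {r} {T} i) = ↭-trans (↭.++⁺ˡ r (Insert-↭ i)) (↭.shift k r (concat T))

Under-∷ʳ⁺ : ∀ {k prev r} → Under prev r → room (Maybe.map length prev) (length r) ≡ true →
  Maybe.All (All (_< k)) prev → Under prev (r ∷ʳ k)
Under-∷ʳ⁺ top       _ _             = top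
Under-∷ʳ⁺ (under o) l (Maybe.just p<k) = under (Over-∷ʳ⁺ o l p<k)

Std-++ : ∀ {p T} q → Std (just p) T → Std (just (p ++ q)) T
Std-++ q []                  = []
Std-++ q (cons (under o) l s) = cons (under (Over-++ q o)) l s

Under-[] : ∀ {prev} → Under prev []
Under-[] {nothing} = top
Under-[] {just _}  = under []

Insert-Std : ∀ {prev k T T′} → Std prev T → Maybe.All (All (_< k)) prev → All (All (_< k)) T →
  Insert (Maybe.map length prev) k T T′ → Std prev T′
Insert-Std {prev} [] p<k _ (new r) = cons (Under-∷ʳ⁺ (Under-[] {prev}) r p<k) [-] []
Insert-Std (cons u l s) p<k (r<k ∷ _)   (here r)  = cons (Under-∷ʳ⁺ u r p<k) (Linked-∷ʳ⁺ l r<k) (Std-++ _ s)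
Insert-Std (cons u l s) p<k (r<k ∷ T<k) (there i) = cons u l (Insert-Std s (Maybe.just r<k) T<k i)

Under-∷ʳ⁻ : ∀ {k prev} r → Under prev (r ∷ʳ k) → Under prev r × room (Maybe.map length prev) (length r) ≡ true
Under-∷ʳ⁻ r top       = top , refl
Under-∷ʳ⁻ r (under o) with o′ , l ← Over-∷ʳ⁻ r o = under o′ , l

Std-init : ∀ {k T} p → Std (just (p ∷ʳ k)) T → All (All (_≤ k)) T → Std (just p) T
Std-init p []                  _         = []
Std-init p (cons (under o) l s) (r≤k ∷ _) = cons (under (Over-init p o r≤k)) l s

Std-remove : ∀ {prev k T′} → Std prev T′ → All (All (_≤ k)) T′ → k ∈ concat T′ →
  ∃[ T ] Std prev T × Insert (Maybe.map length prev) k T T′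
Std-remove {prev} {k} (cons {a} {r} {T} u l s) (r≤k ∷ T≤k) k∈ with member? ℕ._≟_ k (a ∷ r)
... | no k∉ with ∈-++⁻ (a ∷ r) k∈
...   | inj₁ k∈r = contradiction k∈r k∉
...   | inj₂ k∈T with T₀ , s₀ , i ← Std-remove s T≤k k∈T = (a ∷ r) ∷ T₀ , cons u l s₀ , there i
Std-remove {prev} {k} (cons {a} {r} {T} u l s) (r≤k ∷ T≤k) k∈ | yes k∈r with maximum-last l r≤k k∈r
... | b ∷ r₀ , refl with u′ , q ← Under-∷ʳ⁻ {k} (b ∷ r₀) u =
  (b ∷ r₀) ∷ T , cons u′ (Linked-∷ʳ⁻ (b ∷ r₀) l) (Std-init (b ∷ r₀) s T≤k) , here q
-- The row consists of `k` alone; it is the last row, since a row beneath would start with a larger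
-- entry.
... | [] , refl with s
...   | [] = [] , [] , new (proj₂ (Under-∷ʳ⁻ {k} [] u))
...   | cons (under (k<b ∷ _)) _ _ with (b≤k ∷ _) ∷ _ ← T≤k = contradiction k<b (ℕ.≤⇒≯ b≤k)

-- Enumerating all standard tableaux of a given size

tableaux : ℕ → List Tableau
tableaux zero    = [] ∷ []
tableaux (suc m) = concatMap (insertions nothing (suc m)) (tableaux m)

IsStd : ℕ → Tableau → Set
IsStd m T = Std nothing T × concat T ↭ [1⋯ m ]

[1⋯suc] : ∀ m → [1⋯ suc m ] ↭ suc m ∷ [1⋯ m ]
[1⋯suc] m = ↭-trans (↭-reflexive (sym (applyUpTo-∷ʳ suc m))) (↭-sym (↭.∷↭∷ʳ (suc m) [1⋯ m ]))

∈[1⋯]⇒≤ : ∀ {m a} → a ∈ [1⋯ m ] → a ≤ m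
∈[1⋯]⇒≤ {m} a∈ with i , i<m , refl ← ∈-applyUpTo⁻ suc {n = m} a∈ = i<m

entries≤ : ∀ {m T} → IsStd m T → All (All (_≤ m)) T
entries≤ {m} {T} (_ , c) = All.concat⁻ (↭.All-resp-↭ (↭-sym c) (All.tabulate (∈[1⋯]⇒≤ {m})))

entries< : ∀ {m T} → IsStd m T → All (All (_< suc m)) T
entries< p = All.map (All.map s≤s) (entries≤ p)

∈-tableaux⁻ : ∀ m {T} → T ∈ tableaux m → IsStd m T
∈-tableaux⁻ zero (here refl) = [] , ↭-refl
∈-tableaux⁻ (suc m) T∈ with T₀ , T₀∈ , T∈ ← find (∈-concatMap⁻ (insertions nothing (suc m)) {xs = tableaux m} T∈)
  with p@(s , c) ← ∈-tableaux⁻ m T₀∈ | i ← ∈-insertions⁻ T₀ T∈ =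
  Insert-Std s Maybe.nothing (entries< p) i ,
  ↭-trans (Insert-↭ i) (↭-trans (↭-prep (suc m) c) (↭-sym ([1⋯suc] m)))

∈-tableaux⁺ : ∀ m {T} → IsStd m T → T ∈ tableaux m
∈-tableaux⁺ zero ([] , c) = here refl
∈-tableaux⁺ zero (cons _ _ _ , c) with () ← ↭.↭-length c
∈-tableaux⁺ (suc m) p@(s , c)
  with T₀ , s₀ , i ← Std-remove s (entries≤ p) (↭.∈-resp-↭ (↭-sym (↭-trans c ([1⋯suc] m))) (here refl)) =
  ∈-concatMap⁺ (insertions nothing (suc m)) (lose
    (∈-tableaux⁺ m (s₀ , ↭.drop-∷ (↭-trans (↭-sym (Insert-↭ i)) (↭-trans c ([1⋯suc] m)))))
    (∈-insertions⁺ i))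

Over⁺ : ∀ {p r} → length r ≤ length p → Above p r → Over p r
Over⁺ {r = []}            _        _           = []
Over⁺ {_ ∷ _} {_ ∷ _} (s≤s l) (a<b ∷ q) = a<b ∷ Over⁺ l q

Over⁻ : ∀ {p r} → Over p r → length r ≤ length p × Above p r
Over⁻ {[]}    [] = z≤n , []
Over⁻ {_ ∷ _} [] = z≤n , []
Over⁻ (a<b ∷ o) with l , q ← Over⁻ o = s≤s l , a<b ∷ q

Std⁺ : ∀ {prev r T} → Under prev r → All (_> 0) (map length (r ∷ T)) → Linked _≥_ (map length (r ∷ T)) →
  All (Linked _<_) (r ∷ T) → Linked Above (r ∷ T) → Std prev (r ∷ T)
Std⁺ {r = []}    {[]}    u (() ∷ _)
Std⁺ {r = _ ∷ _} {[]}    u _       _       (l ∷ _)  _       = cons u l []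
Std⁺ {r = _ ∷ _} {s ∷ T} u (_ ∷ p) (d ∷ ds) (l ∷ ls) (c ∷ cs) = cons u l (Std⁺ (under (Over⁺ d c)) p ds ls cs)

record Rows (T : Tableau) : Set where
  constructor rows
  field
    nonempty  : All (_> 0) (map length T)
    shorter   : Linked _≥_ (map length T)
    rowwise   : All (Linked _<_) T
    columnwise : Linked Above T

Std⁻ : ∀ {prev T} → Std prev T → Rows T
Std⁻ [] = rows [] [] [] []
Std⁻ (cons u l []) = rows (z<s ∷ []) [-] (l ∷ []) [-]
Std⁻ (cons u l s@(cons (under o) _ _))
  with rows n d r c ← Std⁻ s | e , a ← Over⁻ o = rows (z<s ∷ n) (e ∷ d) (l ∷ r) (a ∷ c)

length-concat : ∀ (T : Tableau) → length (concat T) ≡ sum (map length T)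
length-concat []      = refl
length-concat (r ∷ T) = trans (length-++ r) (cong (length r +_) (length-concat T))

IsStd⇒size : ∀ {m T} → IsStd m T → sum (map length T) ≡ m
IsStd⇒size {m} {T} (_ , c) = trans (sym (length-concat T)) (trans (↭.↭-length c) (length-applyUpTo suc m))

allSYT : ℕ → List Tableau
allSYT m = concatMap SYT (partitions m)

∈-allSYT⁻ : ∀ {m T} → T ∈ allSYT m → map length T ⊢ m × IsSYT (map length T) T
∈-allSYT⁻ {m} T∈ with lam , lam∈ , T∈ ← find (∈-concatMap⁻ SYT {xs = partitions m} T∈)
  with q@(isSYT refl _ _ _) ← Equivalence.to (∈-SYT {lam} {_}) T∈ = Equivalence.to ∈-partitions lam∈ , q

∈-allSYT⇔∈-tableaux : ∀ m {T} → T ∈ allSYT m ⇔ T ∈ tableaux m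
∈-allSYT⇔∈-tableaux m {T} = mk⇔ to from
  where
  build : ∀ {T} → map length T ⊢ m → IsSYT (map length T) T → IsStd m T
  build {[]}    (isPartition _ _ refl) (isSYT _ c _ _) = [] , c
  build {_ ∷ _} (isPartition d p refl) (isSYT _ c l k) = Std⁺ top p d l k , c
  to : T ∈ allSYT m → T ∈ tableaux m
  to T∈ with p , q ← ∈-allSYT⁻ {m} T∈ = ∈-tableaux⁺ m (build p q)
  from : T ∈ tableaux m → T ∈ allSYT m
  from T∈ with p@(s , c) ← ∈-tableaux⁻ m T∈ with refl ← IsStd⇒size p | rows n d l k ← Std⁻ s =
    ∈-concatMap⁺ SYT (lose
      (Equivalence.from (∈-partitions {m = m}) (isPartition d n refl))
      (Equivalence.from ∈-SYT (isSYT refl c l k)))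

allSYT-unique : ∀ m → Unique (allSYT m)
allSYT-unique m = Unique.concat⁺
  (All.map⁺ (All.universal SYT-unique (partitions m)))
  (AllPairs.map⁺ (AllPairs.map
    (λ {lam} {mu} lam≢mu {_} (T∈ , T∈′) → lam≢mu (trans (sym (shape T∈)) (shape T∈′)))
    (partitions-unique m)))
  where
  shape : ∀ {lam T} → T ∈ SYT lam → map length T ≡ lam
  shape T∈ = IsSYT.shape (Equivalence.to ∈-SYT T∈)

prepend : List ℕ → Tableau → Tableau
prepend []      T = T
prepend (a ∷ r) T = (a ∷ r) ∷ T

-- Undoes every insertion of `k`, so insertions into distinct tableaux never coincide.
erase : ℕ → Tableau → Tableau
erase k []      = []
erase k (r ∷ T) = prepend (filter (ℕ._<? k) r) (erase k T)

erase-id : ∀ {prev k T} → Std prev T → All (All (_< k)) T → erase k T ≡ T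
erase-id [] _ = refl
erase-id {k = k} (cons {a} {r} u l s) (r<k ∷ T<k) rewrite filter-all (ℕ._<? k) r<k = cong ((a ∷ r) ∷_) (erase-id s T<k)

erase-Insert : ∀ {prev N k T T′} → Std prev T → All (All (_< k)) T → Insert N k T T′ → erase k T′ ≡ T
erase-Insert {k = k} [] _ (new _) rewrite filter-reject (ℕ._<? k) {xs = []} (ℕ.<-irrefl {k} refl) = refl
erase-Insert {k = k} (cons {a} {r} u l s) (r<k ∷ T<k) (here _)
  rewrite filter-++ (ℕ._<? k) (a ∷ r) (k ∷ [])
        | filter-all (ℕ._<? k) r<k | filter-reject (ℕ._<? k) {xs = []} (ℕ.<-irrefl {k} refl)
        | ++-identityʳ r = cong ((a ∷ r) ∷_) (erase-id s T<k)
erase-Insert {k = k} (cons {a} {r} u l s) (r<k ∷ T<k) (there i) rewrite filter-all (ℕ._<? k) r<k =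
  cong ((a ∷ r) ∷_) (erase-Insert s T<k i)

if-unique : ∀ {A : Set} {x : A} b → Unique (x if b)
if-unique true  = [] ∷ []
if-unique false = []

insertions-unique : ∀ N k T → Unique (insertions N k T)
insertions-unique N k []      = if-unique (room N 0)
insertions-unique N k (r ∷ T) = Unique.++⁺ (if-unique (room N (length r)))
  (Unique.map⁺ ∷-injectiveʳ (insertions-unique _ k T))
  λ (T₁∈ , T₂∈) → case ∈-if⁻ (room N (length r)) T₁∈ , ∈-map⁻ (r ∷_) T₂∈ of
    λ { ((refl , _) , _ , _ , eq) → longer (∷-injectiveˡ eq) }
  where
  longer : r ∷ʳ k ≢ r
  longer eq = ℕ.1+n≢n (trans (sym (trans (length-++-sucʳ r k []) (cong (suc ∘ length) (++-identityʳ r)))) (cong length eq))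

AllPairs-∈ : ∀ {A : Set} {R S : A → A → Set} {xs} → (∀ {x y} → x ∈ xs → y ∈ xs → R x y → S x y) →
  AllPairs.AllPairs R xs → AllPairs.AllPairs S xs
AllPairs-∈ f []       = []
AllPairs-∈ f (p ∷ ps) = All.tabulate (λ y∈ → f (here refl) (there y∈) (All.lookup p y∈)) ∷
  AllPairs-∈ (λ x∈ y∈ → f (there x∈) (there y∈)) ps

tableaux-unique : ∀ m → Unique (tableaux m)
tableaux-unique zero    = [] ∷ []
tableaux-unique (suc m) = Unique.concat⁺
  (All.map⁺ (All.universal (insertions-unique nothing (suc m)) (tableaux m)))
  (AllPairs.map⁺ (AllPairs-∈
    (λ T∈ U∈ T≢U {_} (V∈T , V∈U) → T≢U (trans (sym (erased T∈ V∈T)) (erased U∈ V∈U)))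
    (tableaux-unique m)))
  where
  erased : ∀ {T U} → T ∈ tableaux m → U ∈ insertions nothing (suc m) T → erase (suc m) U ≡ T
  erased {T} T∈ U∈ = let p = ∈-tableaux⁻ m T∈ in erase-Insert (proj₁ p) (entries< p) (∈-insertions⁻ T U∈)

allSYT-↭ : ∀ m → allSYT m ↭ tableaux m
allSYT-↭ m = ∼bag⇒↭ (unique∧set⇒bag (allSYT-unique m) (tableaux-unique m) (∈-allSYT⇔∈-tableaux m))

-- Signed sums over tableaux

∑ : ∀ {A : Set} → List A → (A → ℤ) → ℤ
∑ xs f = foldr (λ x s → f x ℤ.+ s) 0ℤ xs

module _ {A : Set} where

  ∑-↭ : ∀ {xs ys : List A} f → xs ↭ ys → ∑ xs f ≡ ∑ ys f
  ∑-↭ f ↭.refl         = refl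
  ∑-↭ f (↭.prep x p)   = cong (λ z → f x ℤ.+ z) (∑-↭ f p)
  ∑-↭ f (↭.swap x y p) = trans (x+yz≡y+xz (f x) (f y) _) (cong (λ z → f y ℤ.+ (f x ℤ.+ z)) (∑-↭ f p))
  ∑-↭ f (↭.trans p q)  = trans (∑-↭ f p) (∑-↭ f q)

  ∑-cong : ∀ {f g} (xs : List A) → (∀ {x} → x ∈ xs → f x ≡ g x) → ∑ xs f ≡ ∑ xs g
  ∑-cong []       p = refl
  ∑-cong (x ∷ xs) p = cong₂ ℤ._+_ (p (here refl)) (∑-cong xs (p ∘ there))

  ∑-++ : ∀ f (xs ys : List A) → ∑ (xs ++ ys) f ≡ ∑ xs f ℤ.+ ∑ ys f
  ∑-++ f []       ys = sym (ℤ.+-identityˡ _)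
  ∑-++ f (x ∷ xs) ys = trans (cong (λ z → f x ℤ.+ z) (∑-++ f xs ys)) (sym (ℤ.+-assoc (f x) _ _))

  ∑-* : ∀ c f (xs : List A) → ∑ xs (λ x → c ℤ.* f x) ≡ c ℤ.* ∑ xs f
  ∑-* c f []       = sym (ℤ.*-zeroʳ c)
  ∑-* c f (x ∷ xs) = trans (cong (λ z → c ℤ.* f x ℤ.+ z) (∑-* c f xs)) (sym (ℤ.*-distribˡ-+ c (f x) _))

  ∑-if : ∀ f (x : A) b → ∑ (x if b) f ≡ [ b ]· f x
  ∑-if f x true  = ℤ.+-identityʳ (f x)
  ∑-if f x false = refl

  ∑-map : ∀ {B : Set} f (g : B → A) xs → ∑ (map g xs) f ≡ ∑ xs (f ∘ g)
  ∑-map f g []       = refl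
  ∑-map f g (x ∷ xs) = cong (λ z → f (g x) ℤ.+ z) (∑-map f g xs)

  ∑-concatMap : ∀ {B : Set} f (g : B → List A) xs → ∑ (concatMap g xs) f ≡ ∑ xs (λ x → ∑ (g x) f)
  ∑-concatMap f g []       = refl
  ∑-concatMap f g (x ∷ xs) = trans (∑-++ f (g x) _) (cong (λ z → ∑ (g x) f ℤ.+ z) (∑-concatMap f g xs))

smaller-↭ : ∀ {a k w′ w} → w′ ↭ k ∷ w → a < k → length (filter (ℕ._<? a) w′) ≡ length (filter (ℕ._<? a) w)
smaller-↭ {a} p a<k = trans (↭.↭-length (↭.filter-↭ (ℕ._<? a) p)) (cong length (filter-reject (ℕ._<? a) (ℕ.<-asym a<k)))

-- The largest entry is inverted with every entry after it and none before it; this is the sign in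
-- `grow`.
inversions-snoc : ∀ {k} r w → All (_< k) r → All (_< k) w → inversions ((r ∷ʳ k) ++ w) ≡ inversions (r ++ w) + length w
inversions-snoc {k} []      w _ w<k = trans (cong (λ z → length z + inversions w) (filter-all (ℕ._<? k) w<k)) (ℕ.+-comm (length w) _)
inversions-snoc {k} (a ∷ r) w (a<k ∷ r<k) w<k = trans
  (cong₂ _+_ (smaller-↭ (↭-trans (↭-reflexive (++-assoc r (k ∷ []) w)) (↭.shift k r w)) a<k) (inversions-snoc r w r<k w<k))
  (sym (ℕ.+-assoc (length (filter (ℕ._<? a) (r ++ w))) _ _))

-- Inversions starting in `r` only see smaller entries, so `k` does not affect them. Cross-adding
-- expresses this without subtraction.
inversions-lower : ∀ {k w′ w} r → All (_< k) r → w′ ↭ k ∷ w → inversions (r ++ w′) + inversions w ≡ inversions (r ++ w) + inversions w′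
inversions-lower {w′ = w′} {w} [] _ p = ℕ.+-comm (inversions w′) (inversions w)
inversions-lower {k} {w′} {w} (a ∷ r) (a<k ∷ r<k) p = begin
  n′ + inversions (r ++ w′) + inversions w   ≡⟨ ℕ.+-assoc n′ _ _ ⟩
  n′ + (inversions (r ++ w′) + inversions w) ≡⟨ cong₂ _+_ (smaller-↭ (↭-trans (↭.++⁺ˡ r p) (↭.shift k r w)) a<k) (inversions-lower r r<k p) ⟩
  n + (inversions (r ++ w) + inversions w′)  ≡⟨ ℕ.+-assoc n _ _ ⟨
  n + inversions (r ++ w) + inversions w′    ∎
  where
  open ≡-Reasoning
  n′ = length (filter (ℕ._<? a) (r ++ w′))
  n  = length (filter (ℕ._<? a) (r ++ w))

sign-lower : ∀ {k w′ w} r → All (_< k) r → w′ ↭ k ∷ w →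
  sgn (inversions (r ++ w′)) ≡ sgn (inversions (r ++ w)) ℤ.* sgn (inversions w) ℤ.* sgn (inversions w′)
sign-lower {k} {w′} {w} r r<k p = begin
  x                        ≡⟨ sgn-cancel (inversions w) x ⟨
  s ℤ.* (s ℤ.* x)          ≡⟨ cong (s ℤ.*_) (ℤ.*-comm s x) ⟩
  s ℤ.* (x ℤ.* s)          ≡⟨ cong (s ℤ.*_) (trans (sym (sgn-+ (inversions (r ++ w′)) (inversions w)))
                               (trans (cong sgn (inversions-lower r r<k p)) (sgn-+ (inversions (r ++ w)) (inversions w′)))) ⟩
  s ℤ.* (y ℤ.* s′)         ≡⟨ regroup s y s′ ⟩
  y ℤ.* s ℤ.* s′           ∎
  where
  open ≡-Reasoning
  x = sgn (inversions (r ++ w′))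
  y = sgn (inversions (r ++ w))
  s = sgn (inversions w)
  s′ = sgn (inversions w′)
  regroup : ∀ a b c → a ℤ.* (b ℤ.* c) ≡ b ℤ.* a ℤ.* c
  regroup = solve-∀

∑-insertions : ∀ N k T f → All (All (_< k)) T →
  ∑ (insertions N k T) (λ T′ → sign T′ ℤ.* f (map length T′)) ≡ sign T ℤ.* grow N f (map length T)
∑-insertions N k [] f _ = trans (∑-if (λ T′ → sign T′ ℤ.* f (map length T′)) ((k ∷ []) ∷ []) (room N 0)) ([]·-* (room N 0) 1ℤ _)
∑-insertions N k (r ∷ T) f (r<k ∷ T<k) = begin
  ∑ (((r ∷ʳ k) ∷ T) if room N n ++ map (r ∷_) L) g
    ≡⟨ trans (∑-++ g (((r ∷ʳ k) ∷ T) if room N n) _) (cong₂ ℤ._+_ (∑-if g _ (room N n)) (∑-map g (r ∷_) L)) ⟩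
  [ room N n ]· g ((r ∷ʳ k) ∷ T) ℤ.+ ∑ L (λ T′ → g (r ∷ T′))
    ≡⟨ cong₂ ℤ._+_ (trans (cong ([ room N n ]·_) first-row) ([]·-* (room N n) y _)) lower-rows ⟩
  y ℤ.* [ room N n ]· (sgn (sum (map length T)) ℤ.* f (suc n ∷ map length T)) ℤ.+ y ℤ.* grow (just n) (f ∘ (n ∷_)) (map length T)
    ≡⟨ ℤ.*-distribˡ-+ y ([ room N n ]· (sgn (sum (map length T)) ℤ.* f (suc n ∷ map length T))) _ ⟨
  y ℤ.* grow N f (n ∷ map length T) ∎
  where
  open ≡-Reasoning
  n = length r
  L = insertions (just n) k T
  y = sgn (inversions (r ++ concat T))
  s = sgn (inversions (concat T))
  g = λ T′ → sign T′ ℤ.* f (map length T′)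

  first-row : g ((r ∷ʳ k) ∷ T) ≡ y ℤ.* (sgn (sum (map length T)) ℤ.* f (suc n ∷ map length T))
  first-row = begin
    sgn (inversions ((r ∷ʳ k) ++ concat T)) ℤ.* f (length (r ∷ʳ k) ∷ map length T)
      ≡⟨ cong₂ ℤ._*_
           (trans (cong sgn (trans (inversions-snoc r (concat T) r<k (All.concat⁺ T<k))
              (cong (inversions (r ++ concat T) +_) (length-concat T)))) (sgn-+ (inversions (r ++ concat T)) _))
           (cong (λ l → f (l ∷ map length T)) (trans (length-++-sucʳ r k []) (cong (suc ∘ length) (++-identityʳ r)))) ⟩
    y ℤ.* sgn (sum (map length T)) ℤ.* f (suc n ∷ map length T)
      ≡⟨ ℤ.*-assoc y _ _ ⟩
    y ℤ.* (sgn (sum (map length T)) ℤ.* f (suc n ∷ map length T)) ∎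

  lower-rows : ∑ L (λ T′ → g (r ∷ T′)) ≡ y ℤ.* grow (just n) (f ∘ (n ∷_)) (map length T)
  lower-rows = begin
    ∑ L (λ T′ → g (r ∷ T′))
      ≡⟨ ∑-cong L (λ {T′} T′∈ → trans
           (cong (ℤ._* f (n ∷ map length T′)) (sign-lower r r<k (Insert-↭ (∈-insertions⁻ T T′∈))))
           (ℤ.*-assoc (y ℤ.* s) (sign T′) _)) ⟩
    ∑ L (λ T′ → y ℤ.* s ℤ.* (sign T′ ℤ.* f (n ∷ map length T′)))
      ≡⟨ ∑-* (y ℤ.* s) _ L ⟩
    y ℤ.* s ℤ.* ∑ L (λ T′ → sign T′ ℤ.* f (n ∷ map length T′))
      ≡⟨ cong (y ℤ.* s ℤ.*_) (∑-insertions (just n) k T (f ∘ (n ∷_)) T<k) ⟩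
    y ℤ.* s ℤ.* (s ℤ.* G)
      ≡⟨ ℤ.*-assoc y s _ ⟩
    y ℤ.* (s ℤ.* (s ℤ.* G))
      ≡⟨ cong (y ℤ.*_) (sgn-cancel (inversions (concat T)) G) ⟩
    y ℤ.* G ∎
    where G = grow (just n) (f ∘ (n ∷_)) (map length T)

∑-tableaux : ∀ m f → ∑ (tableaux m) (λ T → sign T ℤ.* f (map length T)) ≡ ∂^ m f []
∑-tableaux zero    f = trans (ℤ.+-identityʳ _) (ℤ.*-identityˡ (f []))
∑-tableaux (suc m) f = begin
  ∑ (tableaux (suc m)) g
    ≡⟨ ∑-concatMap g (insertions nothing (suc m)) (tableaux m) ⟩
  ∑ (tableaux m) (λ T → ∑ (insertions nothing (suc m) T) g)
    ≡⟨ ∑-cong (tableaux m) (λ {T} T∈ → ∑-insertions nothing (suc m) T f (entries< (∈-tableaux⁻ m T∈))) ⟩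
  ∑ (tableaux m) (λ T → sign T ℤ.* ∂ f (map length T))
    ≡⟨ ∑-tableaux m (∂ f) ⟩
  ∂^ m (∂ f) [] ∎
  where
  open ≡-Reasoning
  g = λ T → sign T ℤ.* f (map length T)

∑-signImbalance : ∀ m f → ∑ (partitions m) (λ lam → signImbalance lam ℤ.* f lam) ≡ ∂^ m f []
∑-signImbalance m f = begin
  ∑ (partitions m) (λ lam → signImbalance lam ℤ.* f lam)
    ≡⟨ ∑-cong (partitions m) (λ {lam} _ → shapewise lam) ⟩
  ∑ (partitions m) (λ lam → ∑ (SYT lam) g)
    ≡⟨ ∑-concatMap g SYT (partitions m) ⟨
  ∑ (allSYT m) g
    ≡⟨ ∑-↭ g (allSYT-↭ m) ⟩
  ∑ (tableaux m) g
    ≡⟨ ∑-tableaux m f ⟩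
  ∂^ m f [] ∎
  where
  open ≡-Reasoning
  g = λ T → sign T ℤ.* f (map length T)
  shapewise : ∀ lam → signImbalance lam ℤ.* f lam ≡ ∑ (SYT lam) g
  shapewise lam = begin
    signImbalance lam ℤ.* f lam         ≡⟨ ℤ.*-comm (signImbalance lam) (f lam) ⟩
    f lam ℤ.* ∑ (SYT lam) sign          ≡⟨ ∑-* (f lam) sign (SYT lam) ⟨
    ∑ (SYT lam) (λ T → f lam ℤ.* sign T) ≡⟨ ∑-cong (SYT lam) (λ {T} T∈ → trans (ℤ.*-comm (f lam) (sign T))
      (cong (λ μ → sign T ℤ.* f μ) (sym (IsSYT.shape (Equivalence.to ∈-SYT T∈))))) ⟩
    ∑ (SYT lam) g ∎

-- The conjugate partition

column : List ℕ → ℕ → ℕ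
column lam j = length (filter (suc j ℕ.≤?_) lam)

conjugate-column : ∀ lam → conjugate lam ≡ applyUpTo (column lam) (foldr _⊔_ 0 lam)
conjugate-column lam = map-applyUpTo suc _ (foldr _⊔_ 0 lam)

indicator : ℕ → ℕ → ℕ
indicator b j = if j <ᵇ b then 1 else 0

column-∷ : ∀ a lam j → column (a ∷ lam) j ≡ indicator a j + column lam j
column-∷ a lam j with j <ᵇ a
... | true  = refl
... | false = refl

<ᵇ-upward : ∀ {j b a} → b ≤ a → (j <ᵇ b) ≡ true → (j <ᵇ a) ≡ true
<ᵇ-upward {zero}  (s≤s _) _ = refl
<ᵇ-upward {suc j} (s≤s l) p = <ᵇ-upward {j} l p

<ᵇ-downward : ∀ {j b a} → b ≤ a → (j <ᵇ a) ≡ false → (j <ᵇ b) ≡ false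
<ᵇ-downward z≤n             _ = refl
<ᵇ-downward {suc j} (s≤s l) p = <ᵇ-downward {j} l p

column-empty : ∀ {b lam j} → Linked _≥_ (b ∷ lam) → (j <ᵇ b) ≡ false → column lam j ≡ 0
column-empty [-] _ = refl
column-empty {lam = c ∷ lam} {j} (b≥c ∷ l) q = trans (column-∷ c lam j)
  (trans (cong (λ e → (if e then 1 else 0) + column lam j) j≮c) (column-empty l j≮c))
  where j≮c = <ᵇ-downward b≥c q

-- A column that reaches the second row takes a full pair of cells from the first two rows.
-- Otherwise it has at most one cell, which halving discards.
half-column : ∀ {a b lam} → Linked _≥_ (a ∷ b ∷ lam) → ∀ j →
  ⌊ column (a ∷ b ∷ lam) j /2⌋ ≡ indicator b j + ⌊ column lam j /2⌋
half-column {a} {b} {lam} (a≥b ∷ l) j rewrite column-∷ a (b ∷ lam) j | column-∷ b lam j with j <ᵇ b in eq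
... | true  rewrite <ᵇ-upward a≥b eq = refl
... | false rewrite column-empty l eq with j <ᵇ a
...   | true  = refl
...   | false = refl

half-single : ∀ a j → ⌊ column (a ∷ []) j /2⌋ ≡ 0
half-single a j with j <ᵇ a
... | true  = refl
... | false = refl

-- Arguments start at 0, so the odd ones are the columns of even index that `d` selects.
sumTo oddSumTo : (ℕ → ℕ) → ℕ → ℕ
sumTo f zero    = 0
sumTo f (suc n) = f 0 + sumTo (f ∘ suc) n
oddSumTo f (suc (suc n)) = f 1 + oddSumTo (f ∘ suc ∘ suc) n
oddSumTo f _             = 0

v-applyUpTo : ∀ f n → v (applyUpTo f n) ≡ sumTo (⌊_/2⌋ ∘ f) n
v-applyUpTo f zero    = refl
v-applyUpTo f (suc n) = cong (⌊ f 0 /2⌋ +_) (v-applyUpTo (f ∘ suc) n)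

d-applyUpTo : ∀ f n → d (applyUpTo f n) ≡ oddSumTo (⌊_/2⌋ ∘ f) n
d-applyUpTo f zero          = refl
d-applyUpTo f (suc zero)    = refl
d-applyUpTo f (suc (suc n)) = cong (⌊ f 1 /2⌋ +_) (d-applyUpTo (f ∘ suc ∘ suc) n)

sumTo-+ : ∀ {f g h} → (∀ j → f j ≡ g j + h j) → ∀ n → sumTo f n ≡ sumTo g n + sumTo h n
sumTo-+ p zero = refl
sumTo-+ {g = g} p (suc n) = trans (cong₂ _+_ (p 0) (sumTo-+ (p ∘ suc) n)) (ℕ-interchange (g 0) _ _ _)

oddSumTo-+ : ∀ {f g h} → (∀ j → f j ≡ g j + h j) → ∀ n → oddSumTo f n ≡ oddSumTo g n + oddSumTo h n
oddSumTo-+ p zero = refl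
oddSumTo-+ p (suc zero) = refl
oddSumTo-+ {g = g} p (suc (suc n)) = trans (cong₂ _+_ (p 1) (oddSumTo-+ (p ∘ suc ∘ suc) n)) (ℕ-interchange (g 1) _ _ _)

sumTo-0 : ∀ {f} → (∀ j → f j ≡ 0) → ∀ n → sumTo f n ≡ 0
sumTo-0 p zero    = refl
sumTo-0 p (suc n) = cong₂ _+_ (p 0) (sumTo-0 (p ∘ suc) n)

oddSumTo-0 : ∀ {f} → (∀ j → f j ≡ 0) → ∀ n → oddSumTo f n ≡ 0
oddSumTo-0 p zero          = refl
oddSumTo-0 p (suc zero)    = refl
oddSumTo-0 p (suc (suc n)) = cong₂ _+_ (p 1) (oddSumTo-0 (p ∘ suc ∘ suc) n)

sumTo-indicator : ∀ {b n} → b ≤ n → sumTo (indicator b) n ≡ b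
sumTo-indicator {n = n} z≤n = sumTo-0 (λ _ → refl) n
sumTo-indicator (s≤s l) = cong suc (sumTo-indicator l)

oddSumTo-indicator : ∀ {b n} → b ≤ n → oddSumTo (indicator b) n ≡ ⌊ b /2⌋
oddSumTo-indicator {n = n} z≤n = oddSumTo-0 (λ _ → refl) n
oddSumTo-indicator {n = suc zero}    (s≤s z≤n) = refl
oddSumTo-indicator {n = suc (suc n)} (s≤s z≤n) = oddSumTo-0 {λ _ → 0} (λ _ → refl) n
oddSumTo-indicator (s≤s (s≤s l)) = cong suc (oddSumTo-indicator l)

first-tail : ∀ {b lam} → Linked _≥_ (b ∷ lam) → first lam ≤ b
first-tail [-]     = z≤n
first-tail (q ∷ _) = q

-- Allowing `n` to exceed the first part lets the induction drop two rows while keeping all columns.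
sumTo-columns : ∀ {lam n} → Linked _≥_ lam → first lam ≤ n → sumTo (⌊_/2⌋ ∘ column lam) n ≡ evenCells false lam
sumTo-columns {[]}     {n} _ _ = sumTo-0 (λ _ → refl) n
sumTo-columns {a ∷ []} {n} _ _ = sumTo-0 (half-single a) n
sumTo-columns {a ∷ b ∷ lam} {n} l@(b≤a ∷ l′) a≤n = trans (sumTo-+ (half-column l) n)
  (cong₂ _+_ (sumTo-indicator b≤n) (sumTo-columns (Linked.tail l′) (ℕ.≤-trans (first-tail l′) b≤n)))
  where
  b≤n = ℕ.≤-trans b≤a a≤n

oddSumTo-columns : ∀ {lam n} → Linked _≥_ lam → first lam ≤ n → oddSumTo (⌊_/2⌋ ∘ column lam) n ≡ evenHalves false lam
oddSumTo-columns {[]}     {n} _ _ = oddSumTo-0 (λ _ → refl) n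
oddSumTo-columns {a ∷ []} {n} _ _ = oddSumTo-0 (half-single a) n
oddSumTo-columns {a ∷ b ∷ lam} {n} l@(b≤a ∷ l′) a≤n = trans (oddSumTo-+ (half-column l) n)
  (cong₂ _+_ (oddSumTo-indicator b≤n) (oddSumTo-columns (Linked.tail l′) (ℕ.≤-trans (first-tail l′) b≤n)))
  where
  b≤n = ℕ.≤-trans b≤a a≤n

first≤max : ∀ lam → first lam ≤ foldr _⊔_ 0 lam
first≤max []        = z≤n
first≤max (a ∷ lam) = ℕ.m≤m⊔n a _

v-conjugate : ∀ {lam} → Linked _≥_ lam → v (conjugate lam) ≡ evenCells false lam
v-conjugate {lam} l = trans (cong v (conjugate-column lam)) (trans (v-applyUpTo (column lam) (foldr _⊔_ 0 lam)) (sumTo-columns l (first≤max lam)))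

d-conjugate : ∀ {lam} → Linked _≥_ lam → d (conjugate lam) ≡ evenHalves false lam
d-conjugate {lam} l = trans (cong d (conjugate-column lam)) (trans (d-applyUpTo (column lam) (foldr _⊔_ 0 lam)) (oddSumTo-columns l (first≤max lam)))

d-evenHalves : ∀ lam → d lam ≡ evenHalves false lam
d-evenHalves []            = refl
d-evenHalves (_ ∷ [])      = refl
d-evenHalves (a ∷ b ∷ lam) = cong (⌊ b /2⌋ +_) (d-evenHalves lam)

-- Polynomials as linear functionals on weights

Exponents : Set
Exponents = Vec ℕ 4

-- For arbitrary `H`, multiplication by a variable becomes a shift of `H`, so inductions close; `δ`
-- recovers coefficients.
pair : (Exponents → ℤ) → Poly 4 → ℤ
pair H p = ∑ p (λ (c , e) → c ℤ.* H e)

δ : Exponents → Exponents → ℤ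
δ e b = if does (Vec.≡-dec ℕ._≟_ b e) then 1ℤ else 0ℤ

coeff-pair : ∀ p e → coeff p e ≡ pair (δ e) p
coeff-pair []            e = refl
coeff-pair ((c , b) ∷ p) e = cong₂ ℤ._+_ term (coeff-pair p e)
  where
  term : (if does (Vec.≡-dec ℕ._≟_ b e) then c else 0ℤ) ≡ c ℤ.* δ e b
  term with does (Vec.≡-dec ℕ._≟_ b e)
  ... | true  = sym (ℤ.*-identityʳ c)
  ... | false = sym (ℤ.*-zeroʳ c)

pair-∑ₚ : ∀ {A : Set} H (as : List A) f → pair H (∑ₚ as f) ≡ ∑ as (pair H ∘ f)
pair-∑ₚ H []       f = refl
pair-∑ₚ H (a ∷ as) f = trans (∑-++ (λ (c , e) → c ℤ.* H e) (f a) (∑ₚ as f)) (cong (λ z → pair H (f a) ℤ.+ z) (pair-∑ₚ H as f))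

var-^ : ∀ {n} (i : Fin n) k → var i ^ₚ k ≡ (1ℤ , Vec.replicate n 0 [ i ]≔ k) ∷ []
var-^ i zero    = cong (λ e → (1ℤ , e) ∷ []) (sym (zeros i))
  where
  zeros : ∀ {n} (i : Fin n) → Vec.replicate n 0 [ i ]≔ 0 ≡ Vec.replicate n 0
  zeros 0F      = refl
  zeros (Fin.suc i) = cong (0 ∷_) (zeros i)
var-^ i (suc k) = trans (cong (var i *ₚ_) (var-^ i k)) (cong (λ e → (1ℤ , e) ∷ []) (sums i))
  where
  sums : ∀ {n} (i : Fin n) →
    Vec.zipWith _+_ (Vec.replicate n 0 [ i ]≔ 1) (Vec.replicate n 0 [ i ]≔ k) ≡ Vec.replicate n 0 [ i ]≔ suc k
  sums 0F      = cong (suc k ∷_) (Vec.zipWith-replicate _+_ 0 0)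
  sums (Fin.suc i) = cong (0 ∷_) (sums i)

monomial : ∀ i j k l c →
  var {4} 0F ^ₚ i *ₚ var 1F ^ₚ j *ₚ var 2F ^ₚ k *ₚ var 3F ^ₚ l *ₚ const c ≡ (c , i ∷ j ∷ k ∷ l ∷ []) ∷ []
monomial i j k l c rewrite var-^ {4} 0F i | var-^ {4} 1F j | var-^ {4} 2F k | var-^ {4} 3F l
  | ℕ.+-identityʳ i | ℕ.+-identityʳ i | ℕ.+-identityʳ i | ℕ.+-identityʳ i
  | ℕ.+-identityʳ j | ℕ.+-identityʳ j | ℕ.+-identityʳ j
  | ℕ.+-identityʳ k | ℕ.+-identityʳ k | ℕ.+-identityʳ l | ℤ.*-identityˡ c = refl

pair-binomial : ∀ H p → pair H ((var 0F +ₚ var 1F) *ₚ p) ≡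
  pair (λ e → H (Vec.zipWith _+_ (1 ∷ 0 ∷ 0 ∷ 0 ∷ []) e)) p ℤ.+ pair (λ e → H (Vec.zipWith _+_ (0 ∷ 1 ∷ 0 ∷ 0 ∷ []) e)) p
pair-binomial H p = begin
  pair H (map (times eˣ) p ++ (map (times eʸ) p ++ []))
    ≡⟨ ∑-++ g (map (times eˣ) p) _ ⟩
  pair H (map (times eˣ) p) ℤ.+ pair H (map (times eʸ) p ++ [])
    ≡⟨ cong₂ ℤ._+_ (shifted eˣ) (trans (cong (pair H) (++-identityʳ (map (times eʸ) p))) (shifted eʸ)) ⟩
  _ ∎
  where
  open ≡-Reasoning
  g : ℤ × Exponents → ℤ
  g (c , e) = c ℤ.* H e
  eˣ eʸ : Exponents
  eˣ = 1 ∷ 0 ∷ 0 ∷ 0 ∷ []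
  eʸ = 0 ∷ 1 ∷ 0 ∷ 0 ∷ []
  times : Exponents → ℤ × Exponents → ℤ × Exponents
  times u (c , e) = 1ℤ ℤ.* c , Vec.zipWith _+_ u e
  shifted : ∀ u → pair H (map (times u) p) ≡ pair (λ e → H (Vec.zipWith _+_ u e)) p
  shifted u = trans (∑-map g (times u) p) (∑-cong p (λ {(c , e)} _ → cong (ℤ._* H (Vec.zipWith _+_ u e)) (ℤ.*-identityˡ c)))

weight : (Exponents → ℤ) → Weight
weight H i j k = H (i ∷ j ∷ k ∷ k ∷ [])

-- Both sides obey one recursion in steps of two. The initial values agree because the empty
-- partition and the single cell both have weight 1.
pair-power : ∀ m H → pair H ((var 0F +ₚ var 1F) ^ₚ ⌊ m /2⌋) ≡ ∂^ m (weigh false (weight H)) []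
pair-power zero          H = trans (ℤ.+-identityʳ _) (ℤ.*-identityˡ _)
pair-power (suc zero)    H = trans (ℤ.+-identityʳ _) (ℤ.*-identityˡ _)
pair-power (suc (suc m)) H = trans (pair-binomial H ((var 0F +ₚ var 1F) ^ₚ ⌊ m /2⌋))
  (trans (cong₂ ℤ._+_ (pair-power m _) (pair-power m _)) (sym (∂^-weigh m (weight H))))

theorem4p5 :
    (m : ℕ) → m ≥ 1 →
    let x = var {4} 0F
        y = var {4} 1F
        q = var {4} 2F
        t = var {4} 3F
    in
    ∑ₚ (partitions m) (λ lam →
      x ^ₚ v lam *ₚ y ^ₚ v (conjugate lam) *ₚ
      q ^ₚ d lam *ₚ t ^ₚ d (conjugate lam) *ₚ
      const (signImbalance lam))
    ≈ₚ (x +ₚ y) ^ₚ ⌊ m /2⌋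
theorem4p5 m _ e = begin
  coeff (∑ₚ (partitions m) term) e
    ≡⟨ trans (coeff-pair (∑ₚ (partitions m) term) e) (pair-∑ₚ (δ e) (partitions m) term) ⟩
  ∑ (partitions m) (λ lam → pair (δ e) (term lam))
    ≡⟨ ∑-cong (partitions m) (λ {lam} lam∈ → pair-term (_⊢_.decreasing (Equivalence.to (∈-partitions {m = m}) lam∈))) ⟩
  ∑ (partitions m) (λ lam → signImbalance lam ℤ.* weigh false (weight (δ e)) lam)
    ≡⟨ ∑-signImbalance m (weigh false (weight (δ e))) ⟩
  ∂^ m (weigh false (weight (δ e))) []
    ≡⟨ pair-power m (δ e) ⟨
  pair (δ e) ((x +ₚ y) ^ₚ ⌊ m /2⌋)
    ≡⟨ coeff-pair ((x +ₚ y) ^ₚ ⌊ m /2⌋) e ⟨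
  coeff ((x +ₚ y) ^ₚ ⌊ m /2⌋) e ∎
  where
  open ≡-Reasoning
  x = var {4} 0F
  y = var {4} 1F
  q = var {4} 2F
  t = var {4} 3F
  term = λ lam →
    x ^ₚ v lam *ₚ y ^ₚ v (conjugate lam) *ₚ
    q ^ₚ d lam *ₚ t ^ₚ d (conjugate lam) *ₚ
    const (signImbalance lam)
  pair-term : ∀ {lam} → Linked _≥_ lam → pair (δ e) (term lam) ≡ signImbalance lam ℤ.* weigh false (weight (δ e)) lam
  pair-term {lam} l = begin
    pair (δ e) (term lam)
      ≡⟨ cong (pair (δ e)) (monomial (v lam) (v (conjugate lam)) (d lam) (d (conjugate lam)) (signImbalance lam)) ⟩
    signImbalance lam ℤ.* δ e (v lam ∷ v (conjugate lam) ∷ d lam ∷ d (conjugate lam) ∷ []) ℤ.+ 0ℤ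
      ≡⟨ ℤ.+-identityʳ _ ⟩
    signImbalance lam ℤ.* δ e (v lam ∷ v (conjugate lam) ∷ d lam ∷ d (conjugate lam) ∷ [])
      ≡⟨ cong (λ u → signImbalance lam ℤ.* δ e (v lam ∷ u)) (cong₂ _∷_ (v-conjugate l)
           (cong₂ (λ i j → i ∷ j ∷ []) (d-evenHalves lam) (d-conjugate l))) ⟩
    signImbalance lam ℤ.* weigh false (weight (δ e)) lam ∎
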